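{- Let $A$ be a finite subset of $\mathbb{Z}_{>0}$. For all $\pi\in\Pi_{\Gamma_A}$, $$(-1)^{|\pi|}\mu_{\Pi_{\Gamma_A}}(\hat0,\pi)=\left|\{\sigma\in\mathcal{D}_A : \mathrm{cyc}(\sigma)=\pi\}\right|.$$ Consequently, $$\chi_{\Pi_{\Gamma_A}}(t)=\sum_{k=1}^{|A|}s_D(A,k)\,t^{k-1},$$ where $(-1)^{k}s_D(A,k)$ is equal to the number of D-permutations on $A$ with exactly $k$ cycles.
   Context: For a finite set $A\subset\mathbb{Z}_{>0}$, $\Gamma_A$ is the bipartite graph on vertex set $A$ with an edge $\{u,v\}$ for each $u<v$ in $A$ with $u$ odd and $v$ even. For a finite graph $G$ with vertex set $V$, the bond lattice $\Pi_G$ is the set of partitions $\pi$ of $V$ such that the induced subgraph of $G$ on each block is connected, ordered by: $\pi\le\pi'$ iff every block of $\pi$ is contained in a block of $\pi'$. Its minimum $\hat0$ is the partition into singletons, and $|\pi|$ denotes the number of blocks of $\pi$. For a finite ranked poset $P$ of length $\ell$ with minimum $\hat0$, Möbius function $\mu_P$ and rank function $\mathrm{rk}$, the characteristic polynomial is $\chi_P(t)=\sum_{x\in P}\mu_P(\hat0,x)t^{\ell-\mathrm{rk}(x)}$. A permutation $\sigma$ of $A$ is a D-permutation on $A$ if $i\le\sigma(i)$ whenever $i\in A$ is odd and $i\ge\sigma(i)$ whenever $i\in A$ is even; $\mathcal{D}_A$ is the set of D-permutations on $A$. The cycle support $\mathrm{cyc}(\sigma)$ is the partition of $A$ whose blocks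 are the sets of elements of the cycles of $\sigma$. Fixed points count as cycles and give singleton blocks.
   Formalization: The sign (-1)^{|π|} is corrected to (-1)^{|A|+|π|} (likewise (-1)^{|A|+k} for s_D), as A={1} refutes the original; the sum is Σ_{k=c}^{|A|} s_D(A,k)t^{k-c}, c the number of components of Γ_A, as A={1,3} refutes t^{k-1}. -}

module Defs where

open import Level using (0ℓ; _⊔_) renaming (suc to lsuc)
open import Data.Bool.Base using (Bool; true; false; if_then_else_)
import Data.Bool.Properties as Bool
open import Data.Nat.Base as ℕ using (ℕ; zero; suc; _+_; _∸_)
import Data.Nat.Properties as ℕ
open import Data.Nat.Divisibility using (_∣_; _∣?_)
open import Data.Integer.Base as ℤ using (ℤ; 0ℤ; 1ℤ; -1ℤ; +_)
open import Data.Fin.Base as Fin using (Fin; zero; suc; toℕ; punchIn)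
import Data.Fin.Properties as Fin
open import Data.Fin.Induction using (spo-wellFounded)
open import Data.Fin.Permutation as Perm
  using (Permutation′; _⟨$⟩ʳ_; insert; remove; insert-punchIn; insert-remove)
open import Data.Fin.Subset using (Subset; _∈_; _⊆_)
open import Data.Fin.Subset.Properties using (_∈?_; _⊆?_)
open import Data.Vec.Base as Vec using (Vec; []; _∷_; tabulate)
import Data.Vec.Properties as Vec
open import Data.List.Base
  using (List; []; _∷_; map; foldr; filter; length; lookup; allFin; applyUpTo;
         deduplicate; cartesianProductWith; mapMaybe)
open import Data.List.Relation.Unary.All as All using (All)
open import Data.List.Relation.Unary.Any as Any using (Any; here; there)
import Data.List.Relation.Unary.Any.Properties as Any
import Data.List.Membership.Propositional as List
import Data.List.Membership.Propositional.Properties as List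
import Data.List.Properties as List
import Data.List.Relation.Unary.Enumerates.Setoid as Enumerates
import Data.List.Relation.Unary.Enumerates.Setoid.Properties as Enumerates
import Data.List.Relation.Unary.Unique.Setoid as Unique
import Data.List.Relation.Unary.Unique.DecSetoid.Properties as Unique
open import Data.Maybe.Base as Maybe using (Maybe)
import Data.Maybe.Relation.Unary.Any as MaybeAny
open import Data.Product.Base using (Σ; _×_; _,_; proj₁; proj₂; ∃-syntax)
open import Data.Sum.Base using (_⊎_; inj₁; inj₂; [_,_]′; swap)
open import Function.Base using (_∘_; id)
open import Induction.WellFounded using (WellFounded; Acc; acc; module Subrelation)
import Relation.Binary.Construct.On as On
open import Relation.Binary.Bundles using (DecPoset; DecSetoid)
open import Relation.Binary.Core using (Rel; _⇒_; _⇔_)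
open import Relation.Binary.Construct.Closure.ReflexiveTransitive
  using (Star; ε; _◅_; _◅◅_; gmap; reverse)
open import Relation.Binary.Construct.NonStrictToStrict as Strict using ()
open import Relation.Binary.Definitions using (Decidable; Minimum; Symmetric)
open import Relation.Binary.Structures using (IsDecEquivalence)
open import Relation.Binary.PropositionalEquality as ≡
  using (_≡_; refl; cong; trans; sym; subst)
open import Relation.Nullary using (¬_; yes; no; does)
open import Relation.Nullary.Decidable
  using (Dec; map′; _×-dec_; _⊎-dec_; _→-dec_; ¬?; dec⇒maybe; dec-true)
open import Relation.Nullary.Negation using (contradiction)

sumℤ : List ℤ → ℤ
sumℤ = foldr ℤ._+_ 0ℤ

-- Polynomials in ℤ[t] are coefficient sequences, compared pointwise; only finite
-- sums of monomials are formed.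
Poly : Set
Poly = ℕ → ℤ

monomial : ℤ → ℕ → Poly
monomial a e j = if does (e ℕ.≟ j) then a else 0ℤ

sumPoly : List Poly → Poly
sumPoly ps j = sumℤ (map (λ p → p j) ps)

-- Σ_{k=a}^{b} f k
sumFromTo : ℕ → ℕ → (ℕ → Poly) → Poly
sumFromTo a b f = sumPoly (applyUpTo (λ i → f (a + i)) (suc b ∸ a))

------------------------------------------------------------------------

record FinitePoset c ℓ₁ ℓ₂ : Set (lsuc (c ⊔ ℓ₁ ⊔ ℓ₂)) where
  field
    decPoset : DecPoset c ℓ₁ ℓ₂
  open DecPoset decPoset public
  field
    elements : List Carrier
    complete : Enumerates.IsEnumeration Eq.setoid elements
    unique   : Unique.Unique Eq.setoid elements
    0̂        : Carrier
    minimum  : Minimum _≤_ 0̂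

  open Strict _≈_ _≤_ public using (_<_)

  _<?_ : Decidable _<_
  _<?_ = Strict.<-decidable _≈_ _≤_ _≟_ _≤?_

  private
    index : Carrier → Fin (length elements)
    index x = Any.index (complete x)

    lookup-index : ∀ x → x ≈ lookup elements (index x)
    lookup-index x = Any.lookup-index (complete x)

    <⇒index< : ∀ {x y} → x < y →
               lookup elements (index x) < lookup elements (index y)
    <⇒index< {x} {y} =
      Strict.<-respʳ-≈ _≈_ _≤_ Eq.sym Eq.trans ≤-respʳ-≈ (lookup-index y)
      ∘ Strict.<-respˡ-≈ _≈_ _≤_ Eq.trans ≤-respˡ-≈ (lookup-index x)

  <-wellFounded : WellFounded _<_
  <-wellFounded = Subrelation.wellFounded <⇒index< (On.wellFounded index
    (spo-wellFounded (On.isStrictPartialOrder (lookup elements)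
      (Strict.<-isStrictPartialOrder _≈_ _≤_ isPartialOrder))))

  -- The list of the values  f z _  over all elements z < y.
  below : ∀ {a} {A : Set a} (y : Carrier) → (∀ z → z < y → A) → List A
  below y f = mapMaybe (λ z → Maybe.map (f z) (dec⇒maybe (z <? y))) elements

  μ-acc : ∀ x y → Acc _<_ y → ℤ
  μ-acc x y (acc rs) =
    if does (x ≟ y) then 1ℤ
    else ℤ.- sumℤ (below y λ z z<y →
      if does (x ≤? z) then μ-acc x z (rs z<y) else 0ℤ)

  μ : Carrier → Carrier → ℤ
  μ x y = μ-acc x y (<-wellFounded y)

  rk-acc : ∀ y → Acc _<_ y → ℕ
  rk-acc y (acc rs) =
    foldr ℕ._⊔_ 0 (below y λ z z<y → suc (rk-acc z (rs z<y)))

  -- The length of a longest chain  x₀ < x₁ < ⋯ < y ; in a ranked poset, the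
  -- rank of y.
  rk : Carrier → ℕ
  rk y = rk-acc y (<-wellFounded y)

  below-cong : ∀ {a} {A : Set a} {y} {f g : ∀ z → z < y → A} →
               (∀ z z<y → f z z<y ≡ g z z<y) → below y f ≡ below y g
  below-cong {y = y} {f} {g} f≡g = List.mapMaybe-cong pointwise elements
    where
    pointwise : ∀ z → Maybe.map (f z) (dec⇒maybe (z <? y)) ≡
                      Maybe.map (g z) (dec⇒maybe (z <? y))
    pointwise z with z <? y
    ... | yes z<y = cong Maybe.just (f≡g z z<y)
    ... | no _    = ≡.refl

  μ-acc-irrelevant : ∀ x y (p q : Acc _<_ y) → μ-acc x y p ≡ μ-acc x y q
  μ-acc-irrelevant x y (acc p) (acc q) =
    cong (λ zs → if does (x ≟ y) then 1ℤ else ℤ.- sumℤ zs)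
      (below-cong λ z z<y → cong (λ m → if does (x ≤? z) then m else 0ℤ)
        (μ-acc-irrelevant x z (p z<y) (q z<y)))

  rk-acc-irrelevant : ∀ y (p q : Acc _<_ y) → rk-acc y p ≡ rk-acc y q
  rk-acc-irrelevant y (acc p) (acc q) = cong (foldr ℕ._⊔_ 0)
    (below-cong λ z z<y → cong suc (rk-acc-irrelevant z (p z<y) (q z<y)))

  -- For x ≰ y the sum is empty, so μ x y = 0.
  μ-unfold : ∀ x y → μ x y ≡
    (if does (x ≟ y) then 1ℤ
     else ℤ.- sumℤ (below y λ z _ → if does (x ≤? z) then μ x z else 0ℤ))
  μ-unfold x y with <-wellFounded y
  ... | acc rs = cong (λ zs → if does (x ≟ y) then 1ℤ else ℤ.- sumℤ zs)
      (below-cong λ z z<y → cong (λ m → if does (x ≤? z) then m else 0ℤ)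
        (μ-acc-irrelevant x z (rs z<y) (<-wellFounded z)))

  rk-unfold : ∀ y → rk y ≡ foldr ℕ._⊔_ 0 (below y λ z _ → suc (rk z))
  rk-unfold y with <-wellFounded y
  ... | acc rs = cong (foldr ℕ._⊔_ 0)
    (below-cong λ z z<y → cong suc (rk-acc-irrelevant z (rs z<y) (<-wellFounded z)))

  len : ℕ
  len = foldr ℕ._⊔_ 0 (map rk elements)

  χ : Poly
  χ = sumPoly (map (λ x → monomial (μ 0̂ x) (len ∸ rk x)) elements)

------------------------------------------------------------------------

module _ {n ℓ} {R : Rel (Fin n) ℓ} (R? : Decidable R) where

  private
    -- Reachable by a walk all of whose inner vertices lie in the list.
    Via : List (Fin n) → Rel (Fin n) ℓ
    Via []       x y = x ≡ y ⊎ R x y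
    Via (v ∷ vs) x y = Via vs x y ⊎ (Via vs x v × Via vs v y)

    via? : ∀ vs → Decidable (Via vs)
    via? []       x y = (x Fin.≟ y) ⊎-dec R? x y
    via? (v ∷ vs) x y = via? vs x y ⊎-dec (via? vs x v ×-dec via? vs v y)

    via⇒star : ∀ vs {x y} → Via vs x y → Star R x y
    via⇒star []       (inj₁ refl)    = ε
    via⇒star []       (inj₂ r)       = r ◅ ε
    via⇒star (v ∷ vs) (inj₁ p)       = via⇒star vs p
    via⇒star (v ∷ vs) (inj₂ (p , q)) = via⇒star vs p ◅◅ via⇒star vs q

    direct : ∀ vs {x y} → Via [] x y → Via vs x y
    direct []       p = p
    direct (v ∷ vs) p = inj₁ (direct vs p)

    compose : ∀ {vs v} → v List.∈ vs → ∀ {x y} →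
              Via vs x v → Via vs v y → Via vs x y
    compose (here refl) p q =
      inj₂ ([ id , proj₁ ]′ p , [ id , proj₂ ]′ q)
    compose (there v∈) (inj₁ p)         (inj₁ q)         = inj₁ (compose v∈ p q)
    compose (there v∈) (inj₁ p)         (inj₂ (q₁ , q₂)) = inj₂ (compose v∈ p q₁ , q₂)
    compose (there v∈) (inj₂ (p₁ , p₂)) (inj₁ q)         = inj₂ (p₁ , compose v∈ p₂ q)
    compose (there v∈) (inj₂ (p₁ , _))  (inj₂ (_ , q₂))  = inj₂ (p₁ , q₂)

    star⇒via : ∀ {x y} → Star R x y → Via (allFin n) x y
    star⇒via ε        = direct (allFin n) (inj₁ refl)
    star⇒via (r ◅ rs) = compose (List.∈-allFin _)
                          (direct (allFin n) (inj₂ r)) (star⇒via rs)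

  star? : Decidable (Star R)
  star? x y = map′ (via⇒star _) star⇒via (via? (allFin n) x y)

------------------------------------------------------------------------

record Partition (n : ℕ) : Set₁ where
  field
    SameBlock        : Rel (Fin n) 0ℓ
    isDecEquivalence : IsDecEquivalence SameBlock
  open IsDecEquivalence isDecEquivalence public
    renaming (_≟_ to sameBlock?; refl to same-refl; sym to same-sym; trans to same-trans)
    using ()

  block : Fin n → Subset n
  block i = tabulate (λ j → does (sameBlock? i j))

  blocks : List (Subset n)
  blocks = deduplicate (Vec.≡-dec Bool._≟_) (map block (allFin n))

  ∣_∣ : ℕ
  ∣_∣ = length blocks

open Partition using (SameBlock; sameBlock?; block; blocks; same-refl; same-sym; same-trans)
  renaming (∣_∣ to #blocks) public

_≈ₚ_ _≤ₚ_ : ∀ {n} → Rel (Partition n) 0ℓ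
π ≈ₚ π′ = SameBlock π ⇔ SameBlock π′
π ≤ₚ π′ = All (λ B → Any (B ⊆_) (blocks π′)) (blocks π)

module _ {n} (π : Partition n) where

  ∈-block⁺ : ∀ {i j} → SameBlock π i j → j ∈ block π i
  ∈-block⁺ {i} {j} p = Vec.lookup⇒[]= j _
    (trans (Vec.lookup∘tabulate _ j) (dec-true (sameBlock? π i j) p))

  ∈-block⁻ : ∀ {i j} → j ∈ block π i → SameBlock π i j
  ∈-block⁻ {i} {j} j∈ with sameBlock? π i j
    | trans (sym (Vec.lookup∘tabulate (λ k → does (sameBlock? π i k)) j)) (Vec.[]=⇒lookup j∈)
  ... | yes p | _  = p
  ... | no _  | ()

  ∈-blocks⁺ : ∀ i → block π i List.∈ blocks π
  ∈-blocks⁺ i = List.∈-deduplicate⁺ _ (List.∈-map⁺ (block π) (List.∈-allFin i))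

  ∈-blocks⁻ : ∀ {B} → B List.∈ blocks π → ∃[ i ] B ≡ block π i
  ∈-blocks⁻ B∈ with List.∈-map⁻ (block π) (List.∈-deduplicate⁻ _ (map (block π) (allFin n)) B∈)
  ... | i , _ , B≡ = i , B≡

module _ {n} {π π′ : Partition n} where

  ⇒-to-≤ : SameBlock π ⇒ SameBlock π′ → π ≤ₚ π′
  ⇒-to-≤ f = All.tabulate λ B∈ → contained (∈-blocks⁻ π B∈)
    where
    contained : ∀ {B} → ∃[ i ] B ≡ block π i → Any (B ⊆_) (blocks π′)
    contained (i , refl) = List.lose (∈-blocks⁺ π′ i) (∈-block⁺ π′ ∘ f ∘ ∈-block⁻ π)

  ≤-to-⇒ : π ≤ₚ π′ → SameBlock π ⇒ SameBlock π′
  ≤-to-⇒ π≤π′ {i} {j} i~j with List.find (All.lookup π≤π′ (∈-blocks⁺ π i))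
  ... | B′ , B′∈ , B⊆B′ with ∈-blocks⁻ π′ B′∈
  ... | k , refl = same-trans π′
    (same-sym π′ (∈-block⁻ π′ (B⊆B′ (∈-block⁺ π (same-refl π)))))
    (∈-block⁻ π′ (B⊆B′ (∈-block⁺ π i~j)))

private
  _≤ₚ?_ : ∀ {n} → Decidable (_≤ₚ_ {n})
  π ≤ₚ? π′ = All.all? (λ B → Any.any? (B ⊆?_) (blocks π′)) (blocks π)

  antisym⇒≈ : ∀ {n} {π π′ : Partition n} → π ≤ₚ π′ → π′ ≤ₚ π → π ≈ₚ π′
  antisym⇒≈ {π = π} {π′} p q = ≤-to-⇒ {π = π} {π′} p , ≤-to-⇒ {π = π′} {π} q

_≈ₚ?_ : ∀ {n} → Decidable (_≈ₚ_ {n})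
π ≈ₚ? π′ = map′
  (λ (p , q) → antisym⇒≈ {π = π} {π′} p q)
  (λ (f , g) → ⇒-to-≤ {π = π} {π′} f , ⇒-to-≤ {π = π′} {π} g)
  ((π ≤ₚ? π′) ×-dec (π′ ≤ₚ? π))

partitionDecPoset : ℕ → DecPoset (lsuc 0ℓ) 0ℓ 0ℓ
partitionDecPoset n = record
  { Carrier = Partition n
  ; _≈_ = _≈ₚ_
  ; _≤_ = _≤ₚ_
  ; isDecPartialOrder = record
    { isPartialOrder = record
      { isPreorder = record
        { isEquivalence = record
          { refl  = id , id
          ; sym   = λ (f , g) → g , f
          ; trans = λ (f , g) (f′ , g′) → (λ p → f′ (f p)) , (λ p → g (g′ p))
          }
        ; reflexive = λ {π} {π′} (f , _) → ⇒-to-≤ {π = π} {π′} f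
        ; trans = λ {π} {π′} {π″} p q → ⇒-to-≤ {π = π} {π″}
            (λ r → ≤-to-⇒ {π = π′} {π″} q (≤-to-⇒ {π = π} {π′} p r))
        }
      ; antisym = λ {π} {π′} → antisym⇒≈ {π = π} {π′}
      }
    ; _≟_ = _≈ₚ?_
    ; _≤?_ = _≤ₚ?_
    }
  }

singletons : ∀ {n} → Partition n
singletons = record { SameBlock = _≡_ ; isDecEquivalence = Fin.≡-isDecEquivalence }

private
  vectors : ∀ {A : Set} → List A → ∀ n → List (Vec A n)
  vectors xs zero    = [] ∷ []
  vectors xs (suc n) = cartesianProductWith _∷_ xs (vectors xs n)

  ∈-vectors : ∀ {A : Set} {xs : List A} → (∀ x → x List.∈ xs) →
              ∀ {n} (v : Vec A n) → v List.∈ vectors xs n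
  ∈-vectors all∈ []      = here refl
  ∈-vectors all∈ (x ∷ v) = List.∈-cartesianProductWith⁺ _∷_ (all∈ x) (∈-vectors all∈ v)

  ∈-booleans : ∀ b → b List.∈ (true ∷ false ∷ [])
  ∈-booleans true  = here refl
  ∈-booleans false = there (here refl)

  kernel : ∀ {n} → Vec (Subset n) n → Partition n
  kernel v = record
    { SameBlock = λ i j → Vec.lookup v i ≡ Vec.lookup v j
    ; isDecEquivalence = On.isDecEquivalence (Vec.lookup v)
        (≡.isDecEquivalence (Vec.≡-dec Bool._≟_))
    }

  kernel-block : ∀ {n} (π : Partition n) → π ≈ₚ kernel (tabulate (block π))
  kernel-block π = to , from
    where
    at : ∀ i → Vec.lookup (tabulate (block π)) i ≡ block π i
    at = Vec.lookup∘tabulate (block π)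
    to : SameBlock π ⇒ SameBlock (kernel (tabulate (block π)))
    to {i} {j} p = trans (at i) (trans (Vec.tabulate-cong same) (sym (at j)))
      where
      same : ∀ k → does (sameBlock? π i k) ≡ does (sameBlock? π j k)
      same k with sameBlock? π i k | sameBlock? π j k
      ... | yes _ | yes _ = refl
      ... | no _  | no _  = refl
      ... | yes q | no ¬r = contradiction (same-trans π (same-sym π p) q) ¬r
      ... | no ¬q | yes r = contradiction (same-trans π p r) ¬q
    from : SameBlock (kernel (tabulate (block π))) ⇒ SameBlock π
    from {i} {j} p = ∈-block⁻ π
      (subst (j ∈_) (sym (trans (sym (at i)) (trans p (at j)))) (∈-block⁺ π (same-refl π)))

  -- Complete, but with repetitions.
  rawPartitions : ∀ n → List (Partition n)
  rawPartitions n = map kernel (vectors (vectors (true ∷ false ∷ []) n) n)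

  ∈-rawPartitions : ∀ {n} (π : Partition n) → Any (π ≈ₚ_) (rawPartitions n)
  ∈-rawPartitions π = Any.map (λ { refl → kernel-block π })
    (List.∈-map⁺ kernel (∈-vectors (∈-vectors ∈-booleans) (tabulate (block π))))

------------------------------------------------------------------------

record Graph (n : ℕ) : Set₁ where
  field
    Adj     : Rel (Fin n) 0ℓ
    adj?    : Decidable Adj
    adj-sym : Symmetric Adj
    irrefl  : ∀ {i} → ¬ Adj i i

module _ {n} (G : Graph n) where
  open Graph G

  ConnectedOn : Subset n → Set
  ConnectedOn B = ∀ x y → x ∈ B → y ∈ B →
    Star (λ u v → u ∈ B × v ∈ B × Adj u v) x y

  connectedOn? : ∀ B → Dec (ConnectedOn B)
  connectedOn? B = Fin.all? λ x → Fin.all? λ y →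
    (x ∈? B) →-dec ((y ∈? B) →-dec
      star? (λ u v → (u ∈? B) ×-dec ((v ∈? B) ×-dec adj? u v)) x y)

  IsBond : Partition n → Set
  IsBond π = All ConnectedOn (blocks π)

  isBond? : ∀ π → Dec (IsBond π)
  isBond? π = All.all? connectedOn? (blocks π)

  Bond : Set₁
  Bond = Σ (Partition n) IsBond

  components : Partition n
  components = record
    { SameBlock = Star Adj
    ; isDecEquivalence = record
      { isEquivalence = record
        { refl = ε ; sym = reverse adj-sym ; trans = _◅◅_ }
      ; _≟_ = star? adj?
      }
    }

  private
    bondDecPoset : DecPoset (lsuc 0ℓ) 0ℓ 0ℓ
    bondDecPoset = On.decPoset (partitionDecPoset n) (proj₁ {B = IsBond})

    module B = DecPoset bondDecPoset

    bondDecSetoid : DecSetoid (lsuc 0ℓ) 0ℓ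
    bondDecSetoid = record
      { isDecEquivalence = record { isEquivalence = B.Eq.isEquivalence ; _≟_ = B._≟_ } }

    IsBond-resp : ∀ {π π′} → π ≈ₚ π′ → IsBond π → IsBond π′
    IsBond-resp {π} {π′} (f , g) bond =
      All.tabulate λ B∈ → transfer (∈-blocks⁻ π′ B∈)
      where
      transfer : ∀ {B} → ∃[ i ] B ≡ block π′ i → ConnectedOn B
      transfer (i , refl) x y x∈ y∈ =
        gmap id (λ (u∈ , v∈ , a) → into u∈ , into v∈ , a)
          (All.lookup bond (∈-blocks⁺ π i) x y (out x∈) (out y∈))
        where
        into : ∀ {k} → k ∈ block π i → k ∈ block π′ i
        into = ∈-block⁺ π′ ∘ f ∘ ∈-block⁻ π
        out : ∀ {k} → k ∈ block π′ i → k ∈ block π i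
        out = ∈-block⁺ π ∘ g ∘ ∈-block⁻ π′

    asBond : Partition n → Maybe Bond
    asBond π = Maybe.map (π ,_) (dec⇒maybe (isBond? π))

    asBond-≈ : ∀ {π₀} → IsBond π₀ → ∀ π → π₀ ≈ₚ π →
               MaybeAny.Any (λ β → π₀ ≈ₚ proj₁ β) (asBond π)
    asBond-≈ {π₀} bond π π₀≈π with isBond? π
    ... | yes b = MaybeAny.just π₀≈π
    ... | no ¬b = contradiction (IsBond-resp {π₀} {π} π₀≈π bond) ¬b

    rawBonds : List Bond
    rawBonds = mapMaybe asBond (rawPartitions n)

    ∈-rawBonds : Enumerates.IsEnumeration B.Eq.setoid rawBonds
    ∈-rawBonds (π₀ , bond) = Any.mapMaybe⁺ asBond (rawPartitions n)
      (Any.map⁺ (Any.map (λ {π} → asBond-≈ {π₀} bond π) (∈-rawPartitions π₀)))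

    singletons-isBond : IsBond singletons
    singletons-isBond = All.tabulate λ B∈ → connected (∈-blocks⁻ singletons B∈)
      where
      connected : ∀ {B} → ∃[ i ] B ≡ block singletons i → ConnectedOn B
      connected (i , refl) x y x∈ y∈ with ∈-block⁻ singletons {i} {x} x∈ | ∈-block⁻ singletons {i} {y} y∈
      ... | refl | refl = ε

  bondLattice : FinitePoset (lsuc 0ℓ) 0ℓ 0ℓ
  bondLattice = record
    { decPoset = bondDecPoset
    ; elements = deduplicate B._≟_ rawBonds
    ; complete = Enumerates.deduplicate⁺ bondDecSetoid ∈-rawBonds
    ; unique   = Unique.deduplicate-! bondDecSetoid rawBonds
    ; 0̂        = singletons , singletons-isBond
    ; minimum  = λ (π , _) → ⇒-to-≤ {π = singletons} {π} λ { refl → same-refl π }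
    }

------------------------------------------------------------------------

permDecSetoid : ℕ → DecSetoid 0ℓ 0ℓ
permDecSetoid n = record
  { Carrier = Permutation′ n
  ; _≈_ = Perm._≈_
  ; isDecEquivalence = record
    { isEquivalence = record
      { refl  = λ _ → refl
      ; sym   = λ p i → sym (p i)
      ; trans = λ p q i → trans (p i) (q i)
      }
    ; _≟_ = λ σ τ → Fin.all? λ i → (σ ⟨$⟩ʳ i) Fin.≟ (τ ⟨$⟩ʳ i)
    }
  }

private
  rawPermutations : ∀ n → List (Permutation′ n)
  rawPermutations zero    = Perm.id ∷ []
  rawPermutations (suc n) =
    cartesianProductWith (insert zero) (allFin (suc n)) (rawPermutations n)

  insert-cong : ∀ {n} j {σ τ : Permutation′ n} → σ Perm.≈ τ →
                insert zero j σ Perm.≈ insert zero j τ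
  insert-cong j         σ≈τ zero    = refl
  insert-cong j {σ} {τ} σ≈τ (suc k) =
    trans (insert-punchIn zero j σ k)
      (trans (cong (punchIn j) (σ≈τ k)) (sym (insert-punchIn zero j τ k)))

  ∈-rawPermutations : ∀ {n} (σ : Permutation′ n) → Any (σ Perm.≈_) (rawPermutations n)
  ∈-rawPermutations {zero}  σ = here λ ()
  ∈-rawPermutations {suc n} σ = Any.cartesianProductWith⁺ (insert zero)
    (λ { {j} {τ} refl σ′≈τ i → trans (sym (insert-remove zero σ i))
      (insert-cong j {remove zero σ} {τ} σ′≈τ i) })
    (List.∈-allFin (σ ⟨$⟩ʳ zero)) (∈-rawPermutations (remove zero σ))

-- All permutations, each exactly once.
permutations : ∀ n → List (Permutation′ n)
permutations n = deduplicate (DecSetoid._≟_ (permDecSetoid n)) (rawPermutations n)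

permutations-complete : ∀ n →
  Enumerates.IsEnumeration (DecSetoid.setoid (permDecSetoid n)) (permutations n)
permutations-complete n = Enumerates.deduplicate⁺ (permDecSetoid n) ∈-rawPermutations

permutations-unique : ∀ n →
  Unique.Unique (DecSetoid.setoid (permDecSetoid n)) (permutations n)
permutations-unique n = Unique.deduplicate-! (permDecSetoid n) (rawPermutations n)

count : ∀ {n p} {P : Permutation′ n → Set p} → (∀ σ → Dec (P σ)) → ℕ
count {n} P? = length (filter P? (permutations n))

module _ {n} (σ : Permutation′ n) where

  -- σᵏ(i)
  iterate : ℕ → Fin n → Fin n
  iterate zero    i = i
  iterate (suc k) i = iterate k (σ ⟨$⟩ʳ i)

  SameCycle : Rel (Fin n) 0ℓ
  SameCycle i j = ∃[ k ] iterate k i ≡ j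

  private
    Step : Rel (Fin n) 0ℓ
    Step i j = σ ⟨$⟩ʳ i ≡ j

    same⇒star : ∀ k {i j} → iterate k i ≡ j → Star Step i j
    same⇒star zero    refl = ε
    same⇒star (suc k) p    = refl ◅ same⇒star k p

    star⇒same : ∀ {i j} → Star Step i j → SameCycle i j
    star⇒same ε           = 0 , refl
    star⇒same (refl ◅ rs) = let (k , p) = star⇒same rs in suc k , p

    iterate-+ : ∀ d a i → iterate (d + a) i ≡ iterate a (iterate d i)
    iterate-+ zero    a i = refl
    iterate-+ (suc d) a i = iterate-+ d a (σ ⟨$⟩ʳ i)

    σ-injective : ∀ {i j} → σ ⟨$⟩ʳ i ≡ σ ⟨$⟩ʳ j → i ≡ j
    σ-injective p = trans (sym (Perm.inverseˡ σ))
      (trans (cong (σ Perm.⟨$⟩ˡ_) p) (Perm.inverseˡ σ))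

    iterate-injective : ∀ a {i j} → iterate a i ≡ iterate a j → i ≡ j
    iterate-injective zero    p = p
    iterate-injective (suc a) p = σ-injective (iterate-injective a p)

    step-back : ∀ i → Star Step (σ ⟨$⟩ʳ i) i
    step-back i with Fin.pigeonhole (ℕ.n<1+n n) (λ k → iterate (toℕ k) i)
    ... | a , b , a<b , p = same⇒star d (sym (iterate-injective (toℕ a)
      (trans p (trans (cong (λ m → iterate m i) b≡) (iterate-+ (suc d) (toℕ a) i)))))
      where
      d : ℕ
      d = toℕ b ∸ suc (toℕ a)
      b≡ : toℕ b ≡ suc d + toℕ a
      b≡ = sym (trans (sym (ℕ.+-suc d (toℕ a))) (ℕ.m∸n+n≡m a<b))

    star-sym : ∀ {i j} → Star Step i j → Star Step j i
    star-sym ε           = ε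
    star-sym (refl ◅ rs) = star-sym rs ◅◅ step-back _

  cyc : Partition n
  cyc = record
    { SameBlock = SameCycle
    ; isDecEquivalence = record
      { isEquivalence = record
        { refl  = 0 , refl
        ; sym   = λ (k , p) → star⇒same (star-sym (same⇒star k p))
        ; trans = λ (k , p) (l , q) → star⇒same (same⇒star k p ◅◅ same⇒star l q)
        }
      ; _≟_ = λ i j → map′ star⇒same (λ (k , p) → same⇒star k p)
          (star? (λ u v → (σ ⟨$⟩ʳ u) Fin.≟ v) i j)
      }
    }

------------------------------------------------------------------------

-- A finite set A of positive integers is given by a duplicate-free list of its
-- elements; vertices, and the points permuted, are the positions in that list.

Even Odd : ℕ → Set
Even m = 2 ∣ m
Odd m  = ¬ 2 ∣ m

module _ (A : List ℕ) where

  private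
    Arc : Rel (Fin (length A)) 0ℓ
    Arc i j = lookup A i ℕ.< lookup A j × Odd (lookup A i) × Even (lookup A j)

    arc? : Decidable Arc
    arc? i j = (lookup A i ℕ.<? lookup A j)
      ×-dec (¬? (2 ∣? lookup A i) ×-dec (2 ∣? lookup A j))

  Γ : Graph (length A)
  Γ = record
    { Adj     = λ i j → Arc i j ⊎ Arc j i
    ; adj?    = λ i j → arc? i j ⊎-dec arc? j i
    ; adj-sym = swap
    ; irrefl  = [ (λ (_ , o , e) → o e) , (λ (_ , o , e) → o e) ]′
    }

  IsDPermutation : Permutation′ (length A) → Set
  IsDPermutation σ = ∀ i →
    (Odd  (lookup A i) → lookup A i ℕ.≤ lookup A (σ ⟨$⟩ʳ i)) ×
    (Even (lookup A i) → lookup A i ℕ.≥ lookup A (σ ⟨$⟩ʳ i))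

  isDPermutation? : ∀ σ → Dec (IsDPermutation σ)
  isDPermutation? σ = Fin.all? λ i →
    (¬? (2 ∣? lookup A i) →-dec (lookup A i ℕ.≤? lookup A (σ ⟨$⟩ʳ i))) ×-dec
    ((2 ∣? lookup A i) →-dec (lookup A (σ ⟨$⟩ʳ i) ℕ.≤? lookup A i))

  #D-withSupport : Partition (length A) → ℕ
  #D-withSupport π = count λ σ → isDPermutation? σ ×-dec (cyc σ ≈ₚ? π)

  #D-withCycles : ℕ → ℕ
  #D-withCycles k = count λ σ → isDPermutation? σ ×-dec (#blocks (cyc σ) ℕ.≟ k)

  -- This is |A| minus the length of the bond lattice, hence the lowest power of t
  -- in Σ_π μ(0̂,π) t^|π| ; it is 1 when Γ is connected and A nonempty.
  #components : ℕ
  #components = #blocks (components Γ)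

  -- Signed so that  (-1)^(|A|-k) s_D(A,k)  is the number of D-permutations on A
  -- with k cycles: the bond lattice has rank function |A| - |π|, so its Möbius
  -- function alternates as (-1)^(|A|-|π|), which is (-1)^|π| only for |A| even.
  s-D : ℕ → ℤ
  s-D k = -1ℤ ℤ.^ (length A + k) ℤ.* + #D-withCycles k

{-# OPTIONS --safe #-}

-- Put F(π) = (-1)^(|A|+|π|) #{σ ∈ D_A : cyc σ = π}. Every cycle support of a
-- D-permutation is a bond partition, because the least element of a nontrivial
-- cycle is odd and the greatest even; so Σ_{ρ ≤ π} F(ρ) is the sum of the signs of
-- the D-permutations which preserve the blocks of π. In a nontrivial block of a bond
-- partition the least element m is odd and the greatest element M is even, hence
-- the D-condition does not restrict the images of m and M inside the block, and
-- σ ↦ σ ∘ (m M) is a sign-reversing involution. Thus F satisfies the recursion of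
-- μ(0̂,·). For χ, the rank of π is |A| - |π|: a nontrivial bond partition covers the
-- one obtained by isolating a vertex other than m and M (or M, if there is none).

module Submission where

open import Defs
open import Data.Nat.Base using (ℕ; _+_; _∸_; _<_)
open import Data.Integer.Base using (-1ℤ; _^_; _*_; +_)
open import Data.List.Base using (List; length)
open import Data.List.Relation.Unary.All using (All)
open import Data.List.Relation.Unary.Unique.Propositional using (Unique)
open import Data.Product.Base using (_×_; proj₁)
open import Relation.Binary.PropositionalEquality using (_≡_; _≗_)

open import Data.Bool.Base using (if_then_else_)
import Data.Bool.Properties as Bool
open import Data.Empty using (⊥-elim)
open import Data.Fin.Base using (Fin; zero; suc)
import Data.Fin.Permutation as Perm
open Perm using (Permutation′; _⟨$⟩ʳ_; _∘ₚ_; transpose)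
import Data.Fin.Properties as Fin
open import Data.Fin.Subset using (_∈_)
open import Data.Integer.Base as ℤ using (ℤ; 0ℤ; 1ℤ)
import Data.Integer.Properties as ℤ
open import Algebra.Properties.CommutativeSemigroup ℤ.+-commutativeSemigroup using (interchange)
open import Data.List.Base
  using ([]; _∷_; allFin; applyUpTo; deduplicate; filter; foldr; lookup; map; mapMaybe)
import Data.List.Membership.Propositional.Properties as ∈
import Data.List.Membership.Setoid.Properties as ∈ₛ
import Data.List.Properties as List
open import Data.List.Relation.Unary.All as All using ([]; _∷_)
import Data.List.Relation.Unary.All.Properties as All
open import Data.List.Relation.Unary.AllPairs as AllPairs using (_∷_)
open import Data.List.Relation.Unary.Any as Any using (Any; here; there)
import Data.List.Relation.Unary.Enumerates.Setoid.Properties as Enumerates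
import Data.List.Relation.Unary.Unique.DecSetoid.Properties as UniqueDS
import Data.List.Relation.Unary.Unique.Propositional.Properties as UniqueP
import Data.List.Relation.Unary.Unique.Setoid as UniqueS
import Data.Maybe.Base as Maybe
open import Data.Nat.Base as ℕ using (zero; suc; _⊔_)
open import Data.Nat.Divisibility using (_∣?_)
import Data.Nat.Properties as ℕ
open import Data.List.Extrema ℕ.≤-totalOrder
  using (argmin; argmax; argmin-all; argmax-all; f[argmin]≤f[xs]; f[xs]≤f[argmax])
open import Data.Product.Base using (_,_; proj₂; ∃-syntax)
open import Data.Sum.Base as Sum using (_⊎_; inj₁; inj₂; [_,_]′)
import Data.Vec.Properties as Vec
open import Function.Base using (_∘_; id)
open import Function.Bundles using (mk⇔)
import Induction.WellFounded as WF
open import Level using (Level)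
open import Relation.Binary.Bundles using (DecPoset; DecSetoid; Setoid)
open import Relation.Binary.Construct.Closure.ReflexiveTransitive
  using (Star; ε; _◅_; _◅◅_; gmap; reverse)
open import Relation.Binary.Core using (_⇒_)
open import Relation.Binary.PropositionalEquality
  using (_≢_; refl; sym; trans; cong; cong₂; subst; setoid; decSetoid; module ≡-Reasoning)
open import Relation.Nullary using (¬_; Dec; yes; no; does)
open import Relation.Nullary.Decidable using (dec⇒maybe; does-⇔; ¬?; _×-dec_; _⊎-dec_)
open import Relation.Nullary.Negation using (contradiction)

-- Signed sums

private
  variable
    ℓx ℓy ℓp ℓq : Level
    X : Set ℓx
    Y : Set ℓy
    P : Set ℓp
    Q : Set ℓq
    x y : ℤ

-- Only `does d` is inspected, so the conditionals in `μ` and in `monomial` are instances of `when`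
-- by computation.
when : Dec P → ℤ → ℤ
when d x = if does d then x else 0ℤ

when-yes : (d : Dec P) → P → when d x ≡ x
when-yes (yes _) _ = refl
when-yes (no ¬p) p = contradiction p ¬p

when-no : (d : Dec P) → ¬ P → when d x ≡ 0ℤ
when-no (yes p) ¬p = contradiction p ¬p
when-no (no _)  _  = refl

when-cong : (d : Dec P) (e : Dec Q) → (P → Q) → (Q → P) → (P → x ≡ y) →
            when d x ≡ when e y
when-cong (yes p) e to from x≡y = trans (x≡y p) (sym (when-yes e (to p)))
when-cong (no ¬p) e to from x≡y = sym (when-no e λ q → ¬p (from q))

when-congʳ : (d : Dec P) → (P → x ≡ y) → when d x ≡ when d y
when-congʳ d = when-cong d d id id

when-× : (d : Dec P) (e : Dec Q) (de : Dec (P × Q)) → when de x ≡ when d (when e x)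
when-× (yes p) e de = when-cong de e proj₂ (p ,_) λ _ → refl
when-× (no ¬p) e de = when-no de λ pq → ¬p (proj₁ pq)

when-*ˡ : (d : Dec P) → ∀ x y → x * when d y ≡ when d (x * y)
when-*ˡ (yes _) x y = refl
when-*ˡ (no _)  x y = ℤ.*-zeroʳ x

when-*ʳ : (d : Dec P) → ∀ x y → when d x * y ≡ when d (x * y)
when-*ʳ (yes _) x y = refl
when-*ʳ (no _)  x y = refl

when-neg : (d : Dec P) → ∀ x → when d (ℤ.- x) ≡ ℤ.- when d x
when-neg (yes _) x = refl
when-neg (no _)  x = refl

∑ : List X → (X → ℤ) → ℤ
∑ xs f = sumℤ (map f xs)

∑-cong : {f g : X → ℤ} → (∀ x → f x ≡ g x) → ∀ xs → ∑ xs f ≡ ∑ xs g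
∑-cong f≡g []       = refl
∑-cong f≡g (x ∷ xs) = cong₂ ℤ._+_ (f≡g x) (∑-cong f≡g xs)

∑-zero : {f : X → ℤ} → ∀ {xs} → All (λ x → f x ≡ 0ℤ) xs → ∑ xs f ≡ 0ℤ
∑-zero []           = refl
∑-zero (fx≡0 ∷ f≡0) = cong₂ ℤ._+_ fx≡0 (∑-zero f≡0)

∑-0 : ∀ (xs : List X) → ∑ xs (λ _ → 0ℤ) ≡ 0ℤ
∑-0 xs = ∑-zero (All.universal (λ _ → refl) xs)

∑-+ : (f g : X → ℤ) → ∀ xs → ∑ xs (λ x → f x ℤ.+ g x) ≡ ∑ xs f ℤ.+ ∑ xs g
∑-+ f g []       = refl
∑-+ f g (x ∷ xs) = trans (cong (ℤ._+_ (f x ℤ.+ g x)) (∑-+ f g xs)) (interchange (f x) (g x) _ _)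

∑-*ˡ : ∀ c (f : X → ℤ) xs → c * ∑ xs f ≡ ∑ xs (λ x → c * f x)
∑-*ˡ c f []       = ℤ.*-zeroʳ c
∑-*ˡ c f (x ∷ xs) = trans (ℤ.*-distribˡ-+ c (f x) _) (cong (ℤ._+_ (c * f x)) (∑-*ˡ c f xs))

∑-neg : ∀ (f : X → ℤ) xs → ∑ xs (λ x → ℤ.- f x) ≡ ℤ.- ∑ xs f
∑-neg f []       = refl
∑-neg f (x ∷ xs) = trans (cong (ℤ._+_ (ℤ.- f x)) (∑-neg f xs)) (sym (ℤ.neg-distrib-+ (f x) _))

∑-when : (d : Dec P) (f : X → ℤ) → ∀ xs → when d (∑ xs f) ≡ ∑ xs (λ x → when d (f x))
∑-when (yes _) f xs = refl
∑-when (no _)  f xs = sym (∑-0 xs)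

∑-swap : (f : X → Y → ℤ) → ∀ xs ys →
         ∑ xs (λ x → ∑ ys (f x)) ≡ ∑ ys (λ y → ∑ xs (λ x → f x y))
∑-swap f []       ys = sym (∑-0 ys)
∑-swap f (x ∷ xs) ys =
  trans (cong (ℤ._+_ (∑ ys (f x))) (∑-swap f xs ys)) (sym (∑-+ (f x) _ ys))

length-filter-∑ : {P : X → Set ℓp} (P? : ∀ x → Dec (P x)) → ∀ xs →
                  + length (filter P? xs) ≡ ∑ xs (λ x → when (P? x) 1ℤ)
length-filter-∑ P? []       = refl
length-filter-∑ P? (x ∷ xs) with P? x
... | yes _ = cong (ℤ._+_ 1ℤ) (length-filter-∑ P? xs)
... | no _  = trans (length-filter-∑ P? xs) (sym (ℤ.+-identityˡ _))

-1^[m+m]≡1 : ∀ m → -1ℤ ^ (m + m) ≡ 1ℤ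
-1^[m+m]≡1 zero    = refl
-1^[m+m]≡1 (suc m) = trans (cong (λ e → -1ℤ * -1ℤ ^ e) (ℕ.+-suc m m))
  (trans (sym (ℤ.*-assoc -1ℤ -1ℤ (-1ℤ ^ (m + m)))) (trans (ℤ.*-identityˡ _) (-1^[m+m]≡1 m)))

i≡-i⇒i≡0 : ∀ i → i ≡ ℤ.- i → i ≡ 0ℤ
i≡-i⇒i≡0 (+ 0) _ = refl
i≡-i⇒i≡0 (ℤ.+[1+ _ ]) ()
i≡-i⇒i≡0 (ℤ.-[1+ _ ]) ()

module _ {c ℓ} (S : Setoid c ℓ) where
  open Setoid S using (Carrier; _≈_) renaming (sym to ≈-sym; trans to ≈-trans)

  -- `P` holds exactly on the class of `y`, and a list without repetitions up to `≈` contains one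
  -- representative of it. That representative need not be `y` itself, so `h` has to be constant on
  -- the class.
  ∑-single : {P : Carrier → Set ℓp} (P? : ∀ x → Dec (P x)) (h : Carrier → ℤ) →
             ∀ {xs y} → UniqueS.Unique S xs → Any (y ≈_) xs →
             (∀ {x} → P x → y ≈ x) → (∀ {x} → y ≈ x → P x) →
             (∀ {x} → y ≈ x → h x ≡ h y) →
             ∑ xs (λ x → when (P? x) (h x)) ≡ h y
  ∑-single P? h {y = y} (x∉xs ∷ _) (here y≈x) to from h≡ =
    trans (cong₂ ℤ._+_
            (trans (when-yes (P? _) (from y≈x)) (h≡ y≈x))
            (∑-zero (All.map (λ x≉z → when-no (P? _) λ Pz → x≉z (≈-trans (≈-sym y≈x) (to Pz)))
              x∉xs)))
          (ℤ.+-identityʳ (h y))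
  ∑-single P? h {xs = x ∷ xs} {y} (x∉xs ∷ xs!) (there y∈xs) to from h≡ =
    trans (cong₂ ℤ._+_
            (when-no (P? x) λ Px → All.lookupWith
              (λ x≉z y≈z → x≉z (≈-trans (≈-sym (to Px)) y≈z)) x∉xs y∈xs)
            (∑-single P? h xs! y∈xs to from h≡))
          (ℤ.+-identityˡ (h y))

module _ {c ℓ} (S : DecSetoid c ℓ) where
  open DecSetoid S using (Carrier; _≈_; _≟_)
    renaming (setoid to ≈-setoid; sym to ≈-sym; trans to ≈-trans)

  module _ {xs} (xs! : UniqueS.Unique ≈-setoid xs) (∈xs : ∀ y → Any (y ≈_) xs)
           {φ : Carrier → Carrier} (φ-cong : ∀ {x y} → x ≈ y → φ x ≈ φ y)
           (φ-inv : ∀ x → φ (φ x) ≈ x)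
           {g : Carrier → ℤ} (g-cong : ∀ {x y} → x ≈ y → g x ≡ g y) where

    -- The value `φ x` occurs in the list only up to `≈`, so the list is not literally permuted.
    -- Instead both sides are read off from the double sum over pairs with `φ x ≈ y`: for fixed `x`
    -- only the class of `φ x` contributes, and for fixed `y` only that of `φ y`.
    ∑-reindex : ∑ xs (λ x → g (φ x)) ≡ ∑ xs g
    ∑-reindex = begin
      ∑ xs (λ x → g (φ x))
        ≡⟨ ∑-cong (λ x → sym (∑-single ≈-setoid (φ x ≟_) g xs! (∈xs (φ x)) id id
             λ e → g-cong (≈-sym e))) xs ⟩
      ∑ xs (λ x → ∑ xs λ y → when (φ x ≟ y) (g y))
        ≡⟨ ∑-swap _ xs xs ⟩
      ∑ xs (λ y → ∑ xs λ x → when (φ x ≟ y) (g y))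
        ≡⟨ ∑-cong (λ y → ∑-single ≈-setoid (λ x → φ x ≟ y) (λ _ → g y) xs! (∈xs (φ y))
             (λ φx≈y → ≈-trans (φ-cong (≈-sym φx≈y)) (φ-inv _))
             (λ φy≈x → ≈-trans (φ-cong (≈-sym φy≈x)) (φ-inv _))
             λ _ → refl) xs ⟩
      ∑ xs g ∎
      where open ≡-Reasoning

    -- Reindexing along `φ` shows that the sum equals its own negative. Classes fixed by `φ` are
    -- covered too, since `g` must vanish there.
    ∑-sign-reversing : (∀ x → g (φ x) ≡ ℤ.- g x) → ∑ xs g ≡ 0ℤ
    ∑-sign-reversing g∘φ≡-g = i≡-i⇒i≡0 _
      (trans (sym ∑-reindex) (trans (∑-cong g∘φ≡-g xs) (∑-neg g xs)))

-- Möbius and rank functions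

-- `below` with a constant family, over an arbitrary list and decision procedure.
select : {B : Set ℓy} {P : X → Set ℓp} → (∀ x → Dec (P x)) → (X → B) → List X → List B
select P? f = mapMaybe λ x → Maybe.map (λ _ → f x) (dec⇒maybe (P? x))

module _ {P : X → Set ℓp} (P? : ∀ x → Dec (P x)) where

  sumℤ-select : ∀ f xs → sumℤ (select P? f xs) ≡ ∑ xs (λ x → when (P? x) (f x))
  sumℤ-select f []       = refl
  sumℤ-select f (x ∷ xs) with P? x
  ... | yes _ = cong (ℤ._+_ (f x)) (sumℤ-select f xs)
  ... | no _  = trans (sumℤ-select f xs) (sym (ℤ.+-identityˡ _))

  max-select-≤ : ∀ (f : X → ℕ) {m} → (∀ {x} → P x → f x ℕ.≤ m) →
                 ∀ xs → foldr _⊔_ 0 (select P? f xs) ℕ.≤ m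
  max-select-≤ f f≤m []       = ℕ.z≤n
  max-select-≤ f f≤m (x ∷ xs) with P? x
  ... | yes Px = ℕ.⊔-lub (f≤m Px) (max-select-≤ f f≤m xs)
  ... | no _   = max-select-≤ f f≤m xs

  ≤-max-select : ∀ (f : X → ℕ) {m xs} → Any (λ x → P x × m ℕ.≤ f x) xs →
                 m ℕ.≤ foldr _⊔_ 0 (select P? f xs)
  ≤-max-select f {xs = x ∷ xs} (here (Px , m≤fx)) with P? x
  ... | yes _  = ℕ.≤-trans m≤fx (ℕ.m≤m⊔n _ _)
  ... | no ¬Px = contradiction Px ¬Px
  ≤-max-select f {xs = x ∷ xs} (there p) with P? x
  ... | yes _ = ℕ.≤-trans (≤-max-select f p) (ℕ.m≤n⊔m (f x) _)
  ... | no _  = ≤-max-select f p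

module _ {c ℓ₁ ℓ₂} (L : FinitePoset c ℓ₁ ℓ₂) where
  open FinitePoset L hiding (refl; trans) renaming (_<_ to _≺_; _<?_ to _≺?_)

  -- Links sums over the whole interval below `y` to the strict sums in the recursion of `μ`: the
  -- class of `y` contributes exactly one term.
  ∑-≤-split : ∀ y (f : Carrier → ℤ) → (∀ {z} → z ≈ y → f z ≡ f y) →
              ∑ elements (λ z → when (z ≤? y) (f z)) ≡
              ∑ elements (λ z → when (z ≺? y) (f z)) ℤ.+ f y
  ∑-≤-split y f f-resp = begin
    ∑ elements (λ z → when (z ≤? y) (f z))
      ≡⟨ ∑-cong (λ z → split z (z ≟ y)) elements ⟩
    ∑ elements (λ z → when (z ≺? y) (f z) ℤ.+ when (z ≟ y) (f z))
      ≡⟨ ∑-+ _ _ elements ⟩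
    ∑ elements (λ z → when (z ≺? y) (f z)) ℤ.+ ∑ elements (λ z → when (z ≟ y) (f z))
      ≡⟨ cong (ℤ._+_ (∑ elements (λ z → when (z ≺? y) (f z))))
           (∑-single Eq.setoid (_≟ y) f unique (complete y) Eq.sym Eq.sym λ e → f-resp (Eq.sym e)) ⟩
    ∑ elements (λ z → when (z ≺? y) (f z)) ℤ.+ f y ∎
    where
    open ≡-Reasoning
    split : ∀ z (d : Dec (z ≈ y)) → when (z ≤? y) (f z) ≡ when (z ≺? y) (f z) ℤ.+ when d (f z)
    split z (yes z≈y) = trans (when-yes (z ≤? y) (reflexive z≈y))
      (sym (trans (cong (ℤ._+ f z) (when-no (z ≺? y) λ z≺y → proj₂ z≺y z≈y)) (ℤ.+-identityˡ (f z))))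
    split z (no z≉y) = trans
      (when-cong (z ≤? y) (z ≺? y) (_, z≉y) proj₁ λ _ → refl)
      (sym (ℤ.+-identityʳ _))

  -- Vanishing of the sums below every `y` other than `0̂` determines `f y` from the values strictly
  -- below `y`, which is the recursion of `μ 0̂`; the test `0̂ ≤ z` in that recursion always
  -- succeeds. Well-founded induction concludes.
  μ-unique : (f : Carrier → ℤ) → (∀ {y z} → y ≈ z → f y ≡ f z) → f 0̂ ≡ 1ℤ →
             (∀ y → ¬ 0̂ ≈ y → ∑ elements (λ z → when (z ≤? y) (f z)) ≡ 0ℤ) →
             ∀ y → μ 0̂ y ≡ f y
  μ-unique f f-resp f0̂≡1 ∑f≡0 = wfRec (λ y → μ 0̂ y ≡ f y) step
    where
    open WF.All <-wellFounded _ using (wfRec)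
    step : ∀ y → (∀ {z} → z ≺ y → μ 0̂ z ≡ f z) → μ 0̂ y ≡ f y
    step y ih = trans (μ-unfold 0̂ y) body
      where
      open ≡-Reasoning
      body : (if does (0̂ ≟ y) then 1ℤ
              else ℤ.- sumℤ (below y λ z _ → when (0̂ ≤? z) (μ 0̂ z))) ≡ f y
      body with 0̂ ≟ y
      ... | yes 0̂≈y = trans (sym f0̂≡1) (f-resp 0̂≈y)
      ... | no 0̂≉y = begin
        ℤ.- sumℤ (below y λ z _ → when (0̂ ≤? z) (μ 0̂ z))
          ≡⟨ cong (λ s → ℤ.- sumℤ s) (below-cong λ z z≺y →
               trans (when-yes (0̂ ≤? z) (minimum z)) (ih z≺y)) ⟩
        ℤ.- sumℤ (below y λ z _ → f z)
          ≡⟨ cong ℤ.-_ (sumℤ-select (_≺? y) f elements) ⟩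
        ℤ.- s
          ≡⟨ ℤ.+-identityʳ (ℤ.- s) ⟨
        ℤ.- s ℤ.+ 0ℤ
          ≡⟨ cong (ℤ._+_ (ℤ.- s)) (trans (sym (∑f≡0 y 0̂≉y)) (∑-≤-split y f f-resp)) ⟩
        ℤ.- s ℤ.+ (s ℤ.+ f y)
          ≡⟨ ℤ.+-assoc (ℤ.- s) s (f y) ⟨
        ℤ.- s ℤ.+ s ℤ.+ f y
          ≡⟨ cong (ℤ._+ f y) (ℤ.+-inverseˡ s) ⟩
        0ℤ ℤ.+ f y
          ≡⟨ ℤ.+-identityˡ (f y) ⟩
        f y ∎
        where
        s : ℤ
        s = ∑ elements (λ z → when (z ≺? y) (f z))

  -- In the recursion for `rk y`, strict monotonicity bounds every term `suc (r z)` by `r y`, and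
  -- the given `z` with `suc (r z) ≡ r y` attains the bound.
  rk-unique : (r : Carrier → ℕ) → (∀ {y z} → y ≈ z → r y ≡ r z) → r 0̂ ≡ 0 →
              (∀ {z y} → z ≺ y → r z ℕ.< r y) →
              (∀ y → ¬ 0̂ ≈ y → ∃[ z ] z ≺ y × suc (r z) ≡ r y) →
              ∀ y → rk y ≡ r y
  rk-unique r r-resp r0̂≡0 r-mono cover = wfRec (λ y → rk y ≡ r y) step
    where
    open WF.All <-wellFounded _ using (wfRec)
    step : ∀ y → (∀ {z} → z ≺ y → rk z ≡ r z) → rk y ≡ r y
    step y ih = trans (rk-unfold y)
      (trans (cong (foldr _⊔_ 0) (below-cong λ z z≺y → cong suc (ih z≺y)))
             (ℕ.≤-antisym (max-select-≤ (_≺? y) (λ z → suc (r z)) r-mono elements) lower))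
      where
      lower : r y ℕ.≤ foldr _⊔_ 0 (below y λ z _ → suc (r z))
      lower with 0̂ ≟ y
      ... | yes 0̂≈y = ℕ.≤-trans (ℕ.≤-reflexive (trans (sym (r-resp 0̂≈y)) r0̂≡0)) ℕ.z≤n
      ... | no 0̂≉y with cover y 0̂≉y
      ...   | z , z≺y , rz = ≤-max-select (_≺? y) (λ z → suc (r z))
        -- The list contains only some `z′` equivalent to the witness `z`, so both properties of `z`
        -- are transported.
        (Any.map (λ z≈z′ →
            (≤-respˡ-≈ z≈z′ (proj₁ z≺y) , λ z′≈y → proj₂ z≺y (Eq.trans z≈z′ z′≈y))
            , ℕ.≤-reflexive (trans (sym rz) (cong suc (r-resp z≈z′))))
          (complete z))

-- The number of blocks of a partition

module _ {c ℓ} (S : Setoid c ℓ) where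
  open Setoid S using (_≈_) renaming (sym to ≈-sym)

  lookup-injective : ∀ {xs} → UniqueS.Unique S xs → ∀ i j → lookup xs i ≈ lookup xs j → i ≡ j
  lookup-injective (x∉ ∷ xs!) zero    zero    _ = refl
  lookup-injective (x∉ ∷ xs!) zero    (suc j) e = contradiction e (All.lookup x∉ (∈.∈-lookup j))
  lookup-injective (x∉ ∷ xs!) (suc i) zero    e = contradiction (≈-sym e) (All.lookup x∉ (∈.∈-lookup i))
  lookup-injective (x∉ ∷ xs!) (suc i) (suc j) e = cong suc (lookup-injective xs! i j e)

module _ {n} (π : Partition n) where

  sameBlockDecSetoid : DecSetoid _ _
  sameBlockDecSetoid = record { isDecEquivalence = Partition.isDecEquivalence π }

  sameBlockSetoid : Setoid _ _
  sameBlockSetoid = DecSetoid.setoid sameBlockDecSetoid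

  private
    ∼-sym : ∀ {i j} → SameBlock π i j → SameBlock π j i
    ∼-sym = same-sym π
    ∼-trans : ∀ {i j k} → SameBlock π i j → SameBlock π j k → SameBlock π i k
    ∼-trans = same-trans π

  block-cong : ∀ {i j} → SameBlock π i j → block π i ≡ block π j
  block-cong {i} {j} i∼j = Vec.tabulate-cong λ k →
    does-⇔ (mk⇔ (∼-trans (∼-sym i∼j)) (∼-trans i∼j)) (sameBlock? π i k) (sameBlock? π j k)

  block-injective : ∀ {i j} → block π i ≡ block π j → SameBlock π i j
  block-injective {i} {j} e = ∈-block⁻ π (subst (j ∈_) (sym e) (∈-block⁺ π (same-refl π)))

  -- Inequivalent entries have different blocks, so sending an entry to the position of its block is
  -- injective. With the next lemma, blocks can be counted by lists of representatives.
  unique⇒length≤#blocks : ∀ {R} → UniqueS.Unique sameBlockSetoid R → length R ℕ.≤ #blocks π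
  unique⇒length≤#blocks {R} R! = Fin.injective⇒≤ {f = λ k → Any.index (∈-blocks⁺ π (lookup R k))}
    λ {j} {k} e → lookup-injective sameBlockSetoid R! j k
      (block-injective (∈ₛ.index-injective (setoid _) (∈-blocks⁺ π _) (∈-blocks⁺ π _) e))

  -- Each block is sent to the position in `R` of an entry equivalent to a chosen member. This is
  -- injective because `blocks π` has no repetitions.
  covering⇒#blocks≤length : ∀ {R} → (∀ i → Any (SameBlock π i) R) → #blocks π ℕ.≤ length R
  covering⇒#blocks≤length {R} cover = Fin.injective⇒≤ {f = λ k → Any.index (cover (rep k))}
    λ {j} {k} e → lookup-injective (setoid _) blocks! j k
      (trans (proj₂ (∈-blocks⁻ π (∈.∈-lookup j)))
        (trans (block-cong (∈ₛ.index-injective sameBlockSetoid (cover (rep j)) (cover (rep k)) e))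
          (sym (proj₂ (∈-blocks⁻ π (∈.∈-lookup k))))))
    where
    rep : Fin (length (blocks π)) → Fin n
    rep k = proj₁ (∈-blocks⁻ π (∈.∈-lookup k))
    blocks! : UniqueS.Unique (setoid _) (blocks π)
    blocks! = UniqueDS.deduplicate-! (decSetoid (Vec.≡-dec Bool._≟_)) (map (block π) (allFin n))

  #blocks≤n : #blocks π ℕ.≤ n
  #blocks≤n = ℕ.≤-trans
    (covering⇒#blocks≤length λ i → Any.map (λ { refl → same-refl π }) (∈.∈-allFin i))
    (ℕ.≤-reflexive (List.length-tabulate {n = n} (λ i → i)))

  transversal : List (Fin n) → List (Fin n)
  transversal = deduplicate (sameBlock? π)

  transversal-unique : ∀ is → UniqueS.Unique sameBlockSetoid (transversal is)
  transversal-unique = UniqueDS.deduplicate-! sameBlockDecSetoid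

  transversal-covering : ∀ {is} → (∀ i → Any (i ≡_) is) →
                         ∀ i → Any (SameBlock π i) (transversal is)
  transversal-covering ∈is = Enumerates.deduplicate⁺ sameBlockDecSetoid
    λ i → Any.map (λ { refl → same-refl π }) (∈is i)

#blocks-singletons : ∀ n → #blocks (singletons {n}) ≡ n
#blocks-singletons n = ℕ.≤-antisym (#blocks≤n singletons)
  (ℕ.≤-trans (ℕ.≤-reflexive (sym (List.length-tabulate {n = n} (λ i → i))))
    (unique⇒length≤#blocks singletons (UniqueP.allFin⁺ n)))

module _ {n} {π π′ : Partition n} (π⇒π′ : SameBlock π ⇒ SameBlock π′) where

  -- A transversal of the finer partition still meets every block of the coarser one.
  #blocks-antitone : #blocks π′ ℕ.≤ #blocks π
  #blocks-antitone = ℕ.≤-trans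
    (covering⇒#blocks≤length π′ λ i → Any.map π⇒π′ (transversal-covering π ∈.∈-allFin i))
    (unique⇒length≤#blocks π (transversal-unique π (allFin n)))

  module _ {a b} (a≁b : ¬ SameBlock π a b) (a∼′b : SameBlock π′ a b) where

    private
      -- transversal π′ (a ∷ allFin n) computes to a ∷ R, so a represents its π′-block.
      R : List (Fin n)
      R = filter (λ i → ¬? (sameBlock? π′ a i)) (transversal π′ (allFin n))

      a∷R! : UniqueS.Unique (sameBlockSetoid π′) (a ∷ R)
      a∷R! = transversal-unique π′ (a ∷ allFin n)

      a∷R-covering : ∀ i → Any (SameBlock π′ i) (a ∷ R)
      a∷R-covering = transversal-covering π′ λ i → there (∈.∈-allFin i)

      #blocks-π′ : #blocks π′ ≡ suc (length R)
      #blocks-π′ = ℕ.≤-antisym (covering⇒#blocks≤length π′ a∷R-covering)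
        (unique⇒length≤#blocks π′ a∷R!)

      a∷b∷R! : UniqueS.Unique (sameBlockSetoid π) (a ∷ b ∷ R)
      a∷b∷R! with a∷R!
      ... | a∉R ∷ R! =
        (a≁b ∷ All.map (_∘ π⇒π′) a∉R)
        ∷ All.map (λ a≁i b∼i → a≁i (same-trans π′ a∼′b (π⇒π′ b∼i))) a∉R
        ∷ AllPairs.map (_∘ π⇒π′) R!

    -- The list `a ∷ R` is a transversal of `π′`. Inserting `b` keeps the entries inequivalent under
    -- `π`, because `R` avoids the `π′`-block of `a`, which also contains `b`.
    #blocks-strictly-antitone : #blocks π′ ℕ.< #blocks π
    #blocks-strictly-antitone = ℕ.≤-trans (ℕ.≤-reflexive (cong suc #blocks-π′))
      (unique⇒length≤#blocks π a∷b∷R!)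

    -- The hypothesis says that only the blocks of `a` and `b` are joined on passing to `π′`. Then
    -- `a ∷ b ∷ R` also meets every block of `π`, so it is a transversal.
    #blocks-merge : (∀ i j → SameBlock π′ i j → SameBlock π i j ⊎ SameBlock π i a ⊎ SameBlock π i b) →
                    #blocks π ≡ suc (#blocks π′)
    #blocks-merge merged = ℕ.≤-antisym
      (ℕ.≤-trans (covering⇒#blocks≤length π λ i → lift i (a∷R-covering i))
                 (ℕ.≤-reflexive (cong suc (sym #blocks-π′))))
      #blocks-strictly-antitone
      where
      in-a∪b : ∀ {i} → SameBlock π i a ⊎ SameBlock π i b → Any (SameBlock π i) (a ∷ b ∷ R)
      in-a∪b = [ here , there ∘ here ]′
      lift : ∀ i → Any (SameBlock π′ i) (a ∷ R) → Any (SameBlock π i) (a ∷ b ∷ R)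
      lift i (here i∼′a)  = [ here , in-a∪b ]′ (merged i a i∼′a)
      lift i (there i∼′r) with Any.any? (sameBlock? π i) R
      ... | yes i∼r = there (there i∼r)
      ... | no  i≁r with sameBlock? π i a | sameBlock? π i b
      ...   | yes i∼a | _       = here i∼a
      ...   | no _    | yes i∼b = there (here i∼b)
      -- Outside the two joined blocks, equivalence under `π′` to an entry of `R` is already
      -- equivalence under `π`.
      ...   | no i≁a  | no i≁b  = contradiction
        (Any.map (λ e → [ id , (λ e → contradiction e [ i≁a , i≁b ]′) ]′ (merged i _ e)) i∼′r)
        i≁r

#blocks-resp : ∀ {n} {π π′ : Partition n} → π ≈ₚ π′ → #blocks π ≡ #blocks π′
#blocks-resp {π = π} {π′} (f , g) =
  ℕ.≤-antisym (#blocks-antitone {π = π′} {π} g) (#blocks-antitone {π = π} {π′} f)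

-- Cycles and transpositions

-- The relation between `σ` and its product with the transposition `(a b)` applied first. Stated by
-- values, it is symmetric in `σ` and `τ`, so splitting a cycle is merging read backwards.
record Twist {n} (σ τ : Permutation′ n) (a b : Fin n) : Set where
  field
    at-a : τ ⟨$⟩ʳ a ≡ σ ⟨$⟩ʳ b
    at-b : τ ⟨$⟩ʳ b ≡ σ ⟨$⟩ʳ a
    at-else : ∀ {i} → i ≢ a → i ≢ b → τ ⟨$⟩ʳ i ≡ σ ⟨$⟩ʳ i

twist-inverse : ∀ {n} {σ τ : Permutation′ n} {a b} → Twist σ τ a b → Twist τ σ a b
twist-inverse t = record
  { at-a = sym at-b ; at-b = sym at-a ; at-else = λ i≢a i≢b → sym (at-else i≢a i≢b) }
  where open Twist t

transpose-twist : ∀ {n} (σ : Permutation′ n) a b → Twist σ (transpose a b ∘ₚ σ) a b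
transpose-twist σ a b = record { at-a = at-a ; at-b = at-b ; at-else = at-else }
  where
  at-a : transpose a b ∘ₚ σ ⟨$⟩ʳ a ≡ σ ⟨$⟩ʳ b
  at-a with a Fin.≟ a
  ... | yes _  = refl
  ... | no a≢a = contradiction refl a≢a
  at-b : transpose a b ∘ₚ σ ⟨$⟩ʳ b ≡ σ ⟨$⟩ʳ a
  at-b with b Fin.≟ a
  ... | yes refl = refl
  ... | no _ with b Fin.≟ b
  ...   | yes _  = refl
  ...   | no b≢b = contradiction refl b≢b
  at-else : ∀ {i} → i ≢ a → i ≢ b → transpose a b ∘ₚ σ ⟨$⟩ʳ i ≡ σ ⟨$⟩ʳ i
  at-else {i} i≢a i≢b with i Fin.≟ a
  ... | yes i≡a = contradiction i≡a i≢a
  ... | no _ with i Fin.≟ b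
  ...   | yes i≡b = contradiction i≡b i≢b
  ...   | no _    = refl

step : ∀ {n} (σ : Permutation′ n) i → SameCycle σ i (σ ⟨$⟩ʳ i)
step σ i = 1 , refl

-- Walking along a cycle never leaves a block, so comparing `cyc τ` with `π` reduces to single
-- applications of `τ`.
SameCycle-least : ∀ {n} (τ : Permutation′ n) (π : Partition n) →
                   (∀ i → SameBlock π i (τ ⟨$⟩ʳ i)) → ∀ {i j} → SameCycle τ i j → SameBlock π i j
SameCycle-least τ π closed (k , p) = go k p
  where
  go : ∀ k {i j} → iterate τ k i ≡ j → SameBlock π i j
  go zero    refl = same-refl π
  go (suc k) p    = same-trans π (closed _) (go k p)

module _ {n} {σ τ : Permutation′ n} {a b} (t : Twist σ τ a b) where
  open Twist t

  private
    _∼_ _∼′_ : Fin n → Fin n → Set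
    _∼_  = SameCycle σ
    _∼′_ = SameCycle τ
    _⨾_ : ∀ {i j k} → i ∼ j → j ∼ k → i ∼ k
    _⨾_ = same-trans (cyc σ)
    _⨾′_ : ∀ {i j k} → i ∼′ j → j ∼′ k → i ∼′ k
    _⨾′_ = same-trans (cyc τ)
    infixr 5 _⨾_ _⨾′_

  -- Up to its first visit to `a` or `b`, a walk of `τ` is a walk of `σ`.
  twist-merges : ∀ i j → i ∼′ j → i ∼ j ⊎ i ∼ a ⊎ i ∼ b
  twist-merges i j (k , p) = go k i p
    where
    go : ∀ k i → iterate τ k i ≡ j → i ∼ j ⊎ i ∼ a ⊎ i ∼ b
    go zero    i refl = inj₁ (same-refl (cyc σ))
    go (suc k) i p with i Fin.≟ a | i Fin.≟ b
    ... | yes refl | _        = inj₂ (inj₁ (same-refl (cyc σ)))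
    ... | no _     | yes refl = inj₂ (inj₂ (same-refl (cyc σ)))
    ... | no i≢a   | no i≢b   = Sum.map (step σ i ⨾_) (Sum.map (step σ i ⨾_) (step σ i ⨾_))
      (go k (σ ⟨$⟩ʳ i) (trans (cong (iterate τ k) (sym (at-else i≢a i≢b))) p))

  -- From `a`, `τ` jumps to `σ b` and then follows the `σ`-cycle of `b`, which misses `a`, until it
  -- returns to `b`.
  twist-joins : ¬ a ∼ b → a ∼′ b
  twist-joins a≁b = subst (a ∼′_) at-a (step τ a) ⨾′ go (proj₁ σb∼b) (σ ⟨$⟩ʳ b) (proj₂ σb∼b)
      λ σb∼a → a≁b (same-sym (cyc σ) (step σ b ⨾ σb∼a))
    where
    σb∼b : (σ ⟨$⟩ʳ b) ∼ b
    σb∼b = same-sym (cyc σ) (step σ b)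
    go : ∀ k i → iterate σ k i ≡ b → ¬ i ∼ a → i ∼′ b
    go zero    i refl _ = same-refl (cyc τ)
    go (suc k) i p i≁a with i Fin.≟ a | i Fin.≟ b
    ... | yes refl | _        = contradiction (same-refl (cyc σ)) i≁a
    ... | no _     | yes refl = same-refl (cyc τ)
    ... | no i≢a   | no i≢b   = subst (i ∼′_) (at-else i≢a i≢b) (step τ i)
      ⨾′ go k (σ ⟨$⟩ʳ i) p λ σi∼a → i≁a (step σ i ⨾ σi∼a)

  -- The cycle of b under τ is the arc of σ leading from σ a to b, which avoids a.
  twist-splits : a ≢ b → a ∼ b → ¬ a ∼′ b
  twist-splits a≢b a∼b a∼′b = a∉Arc (let (k , p) = same-sym (cyc τ) a∼′b in closed k here p)
    where
    data Arc : Fin n → Set where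
      here  : Arc b
      there : ∀ {i} → i ≢ a → i ≢ b → Arc (σ ⟨$⟩ʳ i) → Arc i
    a∉Arc : ¬ Arc a
    a∉Arc here            = a≢b refl
    a∉Arc (there a≢a _ _) = a≢a refl
    -- A `σ`-walk from `i` to `b` either avoids `a` or passes through it; in the second case the
    -- part after the last visit to `a` shows that `σ a` lies on the arc.
    find : ∀ k i → iterate σ k i ≡ b → Arc i ⊎ Arc (σ ⟨$⟩ʳ a)
    find zero    i refl = inj₁ here
    find (suc k) i p with i Fin.≟ a | i Fin.≟ b
    ... | yes refl | _        = inj₂ ([ id , id ]′ (find k (σ ⟨$⟩ʳ a) p))
    ... | no _     | yes refl = inj₁ here
    ... | no i≢a   | no i≢b   = Sum.map₁ (there i≢a i≢b) (find k (σ ⟨$⟩ʳ i) p)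
    σa∈Arc : Arc (σ ⟨$⟩ʳ a)
    σa∈Arc = [ (λ a∈ → contradiction a∈ a∉Arc) , id ]′ (find (proj₁ a∼b) a (proj₂ a∼b))
    closed : ∀ k {i j} → Arc i → iterate τ k i ≡ j → Arc j
    closed zero    i∈                  refl = i∈
    closed (suc k) here                p = closed k (subst Arc (sym at-b) σa∈Arc) p
    closed (suc k) (there i≢a i≢b σi∈) p = closed k (subst Arc (sym (at-else i≢a i≢b)) σi∈) p

  -- Each step of `σ` stays within a cycle of `τ`: at `a` and `b`, because `τ` takes the same step
  -- from the other of the two and both lie in one `τ`-cycle.
  #cycles-merge : ¬ a ∼ b → #blocks (cyc σ) ≡ suc (#blocks (cyc τ))
  #cycles-merge a≁b = #blocks-merge {π = cyc σ} {cyc τ}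
    (SameCycle-least σ (cyc τ) σ-step) a≁b a∼′b twist-merges
    where
    a∼′b : a ∼′ b
    a∼′b = twist-joins a≁b
    σ-step : ∀ i → i ∼′ (σ ⟨$⟩ʳ i)
    σ-step i with i Fin.≟ a | i Fin.≟ b
    ... | yes refl | _        = a∼′b ⨾′ subst (b ∼′_) at-b (step τ b)
    ... | no _     | yes refl = same-sym (cyc τ) a∼′b ⨾′ subst (a ∼′_) at-a (step τ a)
    ... | no i≢a   | no i≢b   = subst (i ∼′_) (at-else i≢a i≢b) (step τ i)

-- If `a` and `b` share a cycle of `σ`, then `τ` separates them, and the merging count applies with
-- `σ` and `τ` exchanged. Either way the parity of the number of cycles changes.
#cycles-twist : ∀ {n} {σ τ : Permutation′ n} {a b} → Twist σ τ a b → a ≢ b →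
                #blocks (cyc σ) ≡ suc (#blocks (cyc τ)) ⊎ #blocks (cyc τ) ≡ suc (#blocks (cyc σ))
#cycles-twist {σ = σ} {a = a} {b} t a≢b with sameBlock? (cyc σ) a b
... | no a≁b  = inj₁ (#cycles-merge t a≁b)
... | yes a∼b = inj₂ (#cycles-merge (twist-inverse t) (twist-splits t a≢b a∼b))

-- Bonds of Γ

module _ {n} (π : Partition n) where

  Alone : Fin n → Set
  Alone i = ∀ j → SameBlock π i j → i ≡ j

  alone? : ∀ i → Alone i ⊎ (∃[ j ] SameBlock π i j × i ≢ j)
  alone? i with Fin.any? (λ j → sameBlock? π i j ×-dec ¬? (i Fin.≟ j))
  ... | yes other  = inj₂ other
  ... | no ¬other = inj₁ alone
    where
    alone : Alone i
    alone j i∼j with i Fin.≟ j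
    ... | yes i≡j = i≡j
    ... | no i≢j  = contradiction (j , i∼j , i≢j) ¬other

  nontrivial-block : ¬ (singletons ≈ₚ π) → ∃[ i ] ∃[ j ] SameBlock π i j × i ≢ j
  nontrivial-block 0̂≉π with Fin.any? (λ i → Fin.any? λ j → sameBlock? π i j ×-dec ¬? (i Fin.≟ j))
  ... | yes found = found
  ... | no ¬found = ⊥-elim (0̂≉π ((λ { refl → same-refl π }) , trivial))
    where
    trivial : ∀ {i j} → SameBlock π i j → i ≡ j
    trivial {i} {j} i∼j with alone? i
    ... | inj₁ alone = alone j i∼j
    ... | inj₂ other = contradiction (i , other) ¬found

  -- Produces the element of rank one less below a bond partition. The disjunct `i ≡ j` is what
  -- relates `x` to itself.
  isolate : Fin n → Partition n
  isolate x = record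
    { SameBlock = _≈_
    ; isDecEquivalence = record
      { isEquivalence = record { refl = inj₁ refl ; sym = ≈-sym ; trans = ≈-trans }
      ; _≟_ = λ i j → (i Fin.≟ j) ⊎-dec (¬? (i Fin.≟ x) ×-dec ¬? (j Fin.≟ x) ×-dec sameBlock? π i j)
      }
    }
    where
    _≈_ : Fin n → Fin n → Set
    i ≈ j = i ≡ j ⊎ i ≢ x × j ≢ x × SameBlock π i j
    ≈-sym : ∀ {i j} → i ≈ j → j ≈ i
    ≈-sym (inj₁ i≡j)               = inj₁ (sym i≡j)
    ≈-sym (inj₂ (i≢x , j≢x , i∼j)) = inj₂ (j≢x , i≢x , same-sym π i∼j)
    ≈-trans : ∀ {i j k} → i ≈ j → j ≈ k → i ≈ k
    ≈-trans (inj₁ refl) q = q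
    ≈-trans (inj₂ p) (inj₁ refl) = inj₂ p
    ≈-trans (inj₂ (i≢x , _ , i∼j)) (inj₂ (_ , k≢x , j∼k)) = inj₂ (i≢x , k≢x , same-trans π i∼j j∼k)

  isolate-⇒ : ∀ x {i j} → SameBlock (isolate x) i j → SameBlock π i j
  isolate-⇒ x (inj₁ refl)          = same-refl π
  isolate-⇒ x (inj₂ (_ , _ , i∼j)) = i∼j

  isolate-alone : ∀ x j → SameBlock (isolate x) x j → x ≡ j
  isolate-alone x j (inj₁ x≡j)       = x≡j
  isolate-alone x j (inj₂ (x≢x , _)) = contradiction refl x≢x

  -- Going back to `π` joins `x` to the rest of its block, which is nonempty because it contains
  -- `y`.
  #blocks-isolate : ∀ {x y} → SameBlock π x y → x ≢ y →
                    #blocks (isolate x) ≡ suc (#blocks π)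
  #blocks-isolate {x} {y} x∼y x≢y = #blocks-merge {π = isolate x} {π}
    (isolate-⇒ x) (λ x≈y → x≢y (isolate-alone x y x≈y)) x∼y merged
    where
    merged : ∀ i j → SameBlock π i j →
             SameBlock (isolate x) i j ⊎ SameBlock (isolate x) i x ⊎ SameBlock (isolate x) i y
    merged i j i∼j with i Fin.≟ x | j Fin.≟ x
    ... | yes i≡x | _        = inj₂ (inj₁ (inj₁ i≡x))
    ... | no i≢x  | no j≢x   = inj₁ (inj₂ (i≢x , j≢x , i∼j))
    ... | no i≢x  | yes refl = inj₂ (inj₂ (inj₂ (i≢x , (λ y≡x → x≢y (sym y≡x)) , same-trans π i∼j x∼y)))

odd≢even : ∀ {k l} → Odd k → Even l → k ≢ l
odd≢even o e refl = o e

odd≤even⇒< : ∀ {k l} → Odd k → Even l → k ℕ.≤ l → k < l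
odd≤even⇒< o e k≤l = ℕ.≤∧≢⇒< k≤l (odd≢even o e)

module _ (A : List ℕ) where

  private
    n : ℕ
    n = length A
    val : Fin n → ℕ
    val = lookup A

  module _ (π : Partition n) where

    private
      members : Fin n → List (Fin n)
      members i = filter (sameBlock? π i) (allFin n)

    block-min : ∀ i → ∃[ m ] SameBlock π i m × (∀ {j} → SameBlock π i j → val m ℕ.≤ val j)
    block-min i = argmin val i (members i)
      , argmin-all val {P = SameBlock π i} (same-refl π) (All.all-filter (sameBlock? π i) (allFin n))
      , λ i∼j → All.lookup (f[argmin]≤f[xs] {f = val} i (members i))
          (∈.∈-filter⁺ (sameBlock? π i) (∈.∈-allFin _) i∼j)

    block-max : ∀ i → ∃[ M ] SameBlock π i M × (∀ {j} → SameBlock π i j → val j ℕ.≤ val M)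
    block-max i = argmax val i (members i)
      , argmax-all val {P = SameBlock π i} (same-refl π) (All.all-filter (sameBlock? π i) (allFin n))
      , λ i∼j → All.lookup (f[xs]≤f[argmax] {f = val} i (members i))
          (∈.∈-filter⁺ (sameBlock? π i) (∈.∈-allFin _) i∼j)

    -- The substitute for connectivity: by `isBond⁺` and `isBond⁻`, a partition is a bond partition
    -- exactly when each vertex is alone in its block or has a spanned block.
    record Spanned (i : Fin n) : Set where
      field
        {m M} : Fin n
        i∼m : SameBlock π i m
        i∼M : SameBlock π i M
        m-odd  : Odd (val m)
        M-even : Even (val M)
        m-min : ∀ {j} → SameBlock π i j → val m ℕ.≤ val j
        M-max : ∀ {j} → SameBlock π i j → val j ℕ.≤ val M

      m∼M : SameBlock π m M
      m∼M = same-trans π (same-sym π i∼m) i∼M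

      m≢M : m ≢ M
      m≢M e = odd≢even m-odd M-even (cong val e)

    -- A vertex of the block is adjacent to m or to M, according to its parity.
    isBond⁺ : (∀ i → Alone π i ⊎ Spanned i) → IsBond (Γ A) π
    isBond⁺ classify = All.tabulate λ B∈ → connected (∈-blocks⁻ π B∈)
      where
      open Graph (Γ A) using (Adj; adj-sym)
      connected : ∀ {B} → ∃[ i ] B ≡ block π i → ConnectedOn (Γ A) B
      connected (i , refl) x y x∈ y∈ with classify i
      ... | inj₁ alone with alone x (∈-block⁻ π x∈) | alone y (∈-block⁻ π y∈)
      ...   | refl | refl = ε
      connected (i , refl) x y x∈ y∈ | inj₂ spanned =
        to-m x∈ ◅◅ reverse (λ (u∈ , v∈ , uv) → v∈ , u∈ , adj-sym uv) (to-m y∈)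
        where
        open Spanned spanned
        m∈ : m ∈ block π i
        m∈ = ∈-block⁺ π i∼m
        M∈ : M ∈ block π i
        M∈ = ∈-block⁺ π i∼M
        to-m : ∀ {v} → v ∈ block π i →
               Star (λ u v → u ∈ block π i × v ∈ block π i × Adj u v) v m
        to-m {v} v∈ with 2 ∣? val v
        ... | yes v-even =
          (v∈ , m∈ , inj₂ (odd≤even⇒< m-odd v-even (m-min (∈-block⁻ π v∈)) , m-odd , v-even)) ◅ ε
        ... | no v-odd =
          (v∈ , M∈ , inj₁ (odd≤even⇒< v-odd M-even (M-max (∈-block⁻ π v∈)) , v-odd , M-even))
          ◅ (M∈ , m∈ , inj₂ (odd≤even⇒< m-odd M-even (m-min i∼M) , m-odd , M-even)) ◅ ε

    -- In a connected block with at least two vertices, `m` and `M` have neighbours inside the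
    -- block. A neighbour of `m` cannot be smaller, so `m` is the odd end of that edge; dually `M`
    -- is an even end.
    isBond⁻ : IsBond (Γ A) π → ∀ i → Alone π i ⊎ Spanned i
    isBond⁻ bond i with alone? π i
    ... | inj₁ alone           = inj₁ alone
    ... | inj₂ (j , i∼j , i≢j) = spanned (block-min i) (block-max i)
      where
      open Graph (Γ A) using (Adj)
      neighbour : ∀ {u} → SameBlock π i u → ∃[ v ] SameBlock π i v × Adj u v
      neighbour {u} i∼u = first (proj₂ (proj₂ other)) (All.lookup bond (∈-blocks⁺ π i) u (proj₁ other)
          (∈-block⁺ π i∼u) (∈-block⁺ π (proj₁ (proj₂ other))))
        where
        -- A path to any other vertex of the block starts with the desired edge; `i` serves as
        -- target unless `u` is `i`, and then `j` does.
        other : ∃[ w ] SameBlock π i w × u ≢ w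
        other with u Fin.≟ i
        ... | yes refl = j , i∼j , i≢j
        ... | no u≢i   = i , same-refl π , u≢i
        first : ∀ {w} → u ≢ w → Star (λ u v → u ∈ block π i × v ∈ block π i × Adj u v) u w →
                ∃[ v ] SameBlock π i v × Adj u v
        first u≢w ε                   = contradiction refl u≢w
        first u≢w ((_ , v∈ , uv) ◅ _) = _ , ∈-block⁻ π v∈ , uv
      spanned : (∃[ m ] SameBlock π i m × (∀ {j} → SameBlock π i j → val m ℕ.≤ val j)) →
                (∃[ M ] SameBlock π i M × (∀ {j} → SameBlock π i j → val j ℕ.≤ val M)) →
                Alone π i ⊎ Spanned i
      spanned (m , i∼m , m-min) (M , i∼M , M-max) with neighbour i∼m | neighbour i∼M
      ... | _ , i∼v , inj₂ (v<m , _) | _ = contradiction v<m (ℕ.≤⇒≯ (m-min i∼v))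
      ... | _ , _ , inj₁ _ | _ , i∼w , inj₁ (M<w , _) = contradiction M<w (ℕ.≤⇒≯ (M-max i∼w))
      ... | _ , _ , inj₁ (_ , m-odd , _) | _ , _ , inj₂ (_ , _ , M-even) = inj₂ record
        { i∼m = i∼m ; i∼M = i∼M ; m-odd = m-odd ; M-even = M-even ; m-min = m-min ; M-max = M-max }

    nontrivial-spanned : IsBond (Γ A) π → ¬ (singletons ≈ₚ π) → ∃[ i ] Spanned i
    nontrivial-spanned bond 0̂≉π with nontrivial-block π 0̂≉π
    ... | i , j , i∼j , i≢j with isBond⁻ bond i
    ...   | inj₁ alone   = contradiction (alone j i∼j) i≢j
    ...   | inj₂ spanned = i , spanned

  -- If the least element of a cycle is even, the D-condition and minimality force it to be fixed,
  -- so the cycle is trivial; likewise for an odd greatest element. Otherwise the cycle is spanned.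
  -- Distinctness of the entries turns equal values into equal positions.
  DPermutation⇒bond : Unique A → ∀ σ → IsDPermutation A σ → IsBond (Γ A) (cyc σ)
  DPermutation⇒bond A! σ D = isBond⁺ (cyc σ) λ i →
      classify i (block-min (cyc σ) i) (block-max (cyc σ) i)
    where
    val-injective : ∀ {i j} → val i ≡ val j → i ≡ j
    val-injective = lookup-injective (setoid ℕ) A! _ _
    fixed : ∀ {i} → σ ⟨$⟩ʳ i ≡ i → ∀ k → iterate σ k i ≡ i
    fixed e zero    = refl
    fixed e (suc k) = trans (cong (iterate σ k) e) (fixed e k)
    fixed⇒alone : ∀ {i m} → SameCycle σ i m → σ ⟨$⟩ʳ m ≡ m → Alone (cyc σ) i
    fixed⇒alone i∼m e j i∼j with same-sym (cyc σ) i∼m | same-trans (cyc σ) (same-sym (cyc σ) i∼m) i∼j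
    ... | k , p | l , q = trans (trans (sym p) (fixed e k)) (trans (sym (fixed e l)) q)
    classify : ∀ i →
      (∃[ m ] SameCycle σ i m × (∀ {j} → SameCycle σ i j → val m ℕ.≤ val j)) →
      (∃[ M ] SameCycle σ i M × (∀ {j} → SameCycle σ i j → val j ℕ.≤ val M)) →
      Alone (cyc σ) i ⊎ Spanned (cyc σ) i
    classify i (m , i∼m , m-min) (M , i∼M , M-max) with 2 ∣? val m | 2 ∣? val M
    ... | yes m-even | _ = inj₁ (fixed⇒alone i∼m (val-injective
      (ℕ.≤-antisym (proj₂ (D m) m-even) (m-min (same-trans (cyc σ) i∼m (step σ m))))))
    ... | no _ | no M-odd = inj₁ (fixed⇒alone i∼M (val-injective
      (ℕ.≤-antisym (M-max (same-trans (cyc σ) i∼M (step σ M))) (proj₁ (D M) M-odd))))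
    ... | no m-odd | yes M-even = inj₂ record
      { i∼m = i∼m ; i∼M = i∼M ; m-odd = m-odd ; M-even = M-even ; m-min = m-min ; M-max = M-max }

  module _ (π : Partition n) where

    -- These are the D-permutations with cycle support below `π`, described pointwise so that the
    -- effect of exchanging two images can be checked directly.
    Compatible : Permutation′ n → Set
    Compatible σ = IsDPermutation A σ × (∀ i → SameBlock π i (σ ⟨$⟩ʳ i))

    -- The D-condition at m and at M is vacuous inside the block, so the images of
    -- m and M may be exchanged.
    twist-compatible : ∀ {i σ τ} (s : Spanned π i) → Twist σ τ (Spanned.m s) (Spanned.M s) →
                       Compatible σ → Compatible τ
    twist-compatible {i} {σ} {τ} s t (D , σ-closed) = τ-D , τ-closed
      where
      open Spanned s
      open Twist t
      τ-closed : ∀ j → SameBlock π j (τ ⟨$⟩ʳ j)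
      τ-closed j with j Fin.≟ m | j Fin.≟ M
      ... | yes refl | _        = subst (SameBlock π m) (sym at-a) (same-trans π m∼M (σ-closed M))
      ... | no _     | yes refl = subst (SameBlock π M) (sym at-b)
        (same-trans π (same-sym π m∼M) (σ-closed m))
      ... | no j≢m   | no j≢M   = subst (SameBlock π j) (sym (at-else j≢m j≢M)) (σ-closed j)
      τ-D : IsDPermutation A τ
      τ-D j with j Fin.≟ m | j Fin.≟ M
      ... | yes refl | _ =
        (λ _ → m-min (same-trans π i∼m (τ-closed m))) , (λ m-even → contradiction m-even m-odd)
      ... | no _ | yes refl =
        (λ M-odd → contradiction M-even M-odd) , (λ _ → M-max (same-trans π i∼M (τ-closed M)))
      ... | no j≢m | no j≢M rewrite at-else j≢m j≢M = D j

    -- What remains of the block of `x` keeps its extremes `m` and `M` if `x` is not `M`. Removing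
    -- `M` is allowed only from the block `{m, M}`, where `m` is left alone.
    isolate-bond : IsBond (Γ A) π → ∀ {i} (s : Spanned π i) → let open Spanned s in
                   ∀ {x} → SameBlock π m x → x ≢ m →
                   x ≢ M ⊎ (∀ k → SameBlock π m k → k ≡ m ⊎ k ≡ M) →
                   IsBond (Γ A) (isolate π x)
    isolate-bond bond {i} s {x} m∼x x≢m x≢M⊎pair = isBond⁺ (isolate π x) classify
      where
      open Spanned s
      restrict : ∀ {j} (s′ : Spanned π j) → j ≢ x → Spanned.m s′ ≢ x → Spanned.M s′ ≢ x →
                 Spanned (isolate π x) j
      restrict s′ j≢x m′≢x M′≢x = record
        { i∼m = inj₂ (j≢x , m′≢x , S′.i∼m) ; i∼M = inj₂ (j≢x , M′≢x , S′.i∼M)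
        ; m-odd = S′.m-odd ; M-even = S′.M-even
        ; m-min = λ j∼k → S′.m-min (isolate-⇒ π x j∼k) ; M-max = λ j∼k → S′.M-max (isolate-⇒ π x j∼k) }
        where module S′ = Spanned s′
      at : ∀ {j} → SameBlock π m j → Spanned π j
      at m∼j = record
        { i∼m = same-sym π m∼j ; i∼M = same-trans π (same-sym π m∼j) m∼M
        ; m-odd = m-odd ; M-even = M-even
        ; m-min = λ j∼k → m-min (same-trans π i∼m (same-trans π m∼j j∼k))
        ; M-max = λ j∼k → M-max (same-trans π i∼m (same-trans π m∼j j∼k)) }
      inside : ∀ j → j ≢ x → SameBlock π m j →
               x ≢ M ⊎ (∀ k → SameBlock π m k → k ≡ m ⊎ k ≡ M) →
               Alone (isolate π x) j ⊎ Spanned (isolate π x) j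
      inside j j≢x m∼j (inj₁ x≢M)  = inj₂ (restrict (at m∼j) j≢x (x≢m ∘ sym) (x≢M ∘ sym))
      inside j j≢x m∼j (inj₂ pair) with x Fin.≟ M
      ... | no x≢M   = inside j j≢x m∼j (inj₁ x≢M)
      ... | yes refl = inj₁ λ
        { k (inj₁ j≡k) → j≡k
        ; k (inj₂ (_ , k≢M , j∼k)) → trans (is-m j≢x m∼j) (sym (is-m k≢M (same-trans π m∼j j∼k))) }
        where
        is-m : ∀ {k} → k ≢ M → SameBlock π m k → k ≡ m
        is-m k≢M m∼k = [ id , (λ e → contradiction e k≢M) ]′ (pair _ m∼k)
      classify : ∀ j → Alone (isolate π x) j ⊎ Spanned (isolate π x) j
      classify j with j Fin.≟ x | sameBlock? π m j
      ... | yes refl | _       = inj₁ (isolate-alone π x)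
      ... | no j≢x   | yes m∼j = inside j j≢x m∼j x≢M⊎pair
      -- A block that does not contain `m` does not contain `x` either, so its extremes survive.
      ... | no j≢x   | no m≁j  = Sum.map
        (λ alone k j∼k → alone k (isolate-⇒ π x j∼k))
        (λ s′ → restrict s′ j≢x
          (λ { refl → m≁j (same-trans π m∼x (same-sym π (Spanned.i∼m s′))) })
          (λ { refl → m≁j (same-trans π m∼x (same-sym π (Spanned.i∼M s′))) }))
        (isBond⁻ π bond j)

    -- The partner `y` is always `m`; its presence in the block of `x` makes isolating `x` increase
    -- the number of blocks by exactly one.
    bond-cover : IsBond (Γ A) π → ¬ (singletons ≈ₚ π) →
                 ∃[ x ] ∃[ y ] SameBlock π x y × x ≢ y × IsBond (Γ A) (isolate π x)
    bond-cover bond 0̂≉π with nontrivial-spanned π bond 0̂≉π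
    ... | i , s with Fin.any? (λ k → sameBlock? π m k ×-dec ¬? (k Fin.≟ m) ×-dec ¬? (k Fin.≟ M))
      where open Spanned s
    ...   | yes (x , m∼x , x≢m , x≢M) =
      x , m , same-sym π m∼x , x≢m , isolate-bond bond s m∼x x≢m (inj₁ x≢M)
      where open Spanned s
    ...   | no ¬third =
      M , m , same-sym π m∼M , M≢m , isolate-bond bond s m∼M M≢m (inj₂ pair)
      where
      open Spanned s
      M≢m : M ≢ m
      M≢m e = m≢M (sym e)
      pair : ∀ k → SameBlock π m k → k ≡ m ⊎ k ≡ M
      pair k m∼k with k Fin.≟ m | k Fin.≟ M
      ... | yes k≡m | _       = inj₁ k≡m
      ... | no _    | yes k≡M = inj₂ k≡M
      ... | no k≢m  | no k≢M  = contradiction (k , m∼k , k≢m , k≢M) ¬third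

-- Connected components as the greatest bond partition

module _ {n} (G : Graph n) where
  open Graph G

  -- A walk that starts in a component stays in it, so every edge of the walk can be certified to
  -- lie inside the block.
  components-bond : IsBond G (components G)
  components-bond = All.tabulate λ B∈ → connected (∈-blocks⁻ (components G) B∈)
    where
    connected : ∀ {B} → ∃[ i ] B ≡ block (components G) i → ConnectedOn G B
    connected (i , refl) x y x∈ y∈ =
      inside i∼x (same-sym (components G) i∼x ◅◅ ∈-block⁻ (components G) y∈)
      where
      i∼x : Star Adj i x
      i∼x = ∈-block⁻ (components G) x∈
      inside : ∀ {u w} → Star Adj i u → Star Adj u w →
               Star (λ u v → u ∈ block (components G) i × v ∈ block (components G) i × Adj u v) u w
      inside i∼u ε          = ε
      inside i∼u (uv ◅ v∼w) =
        (∈-block⁺ (components G) i∼u , ∈-block⁺ (components G) (i∼u ◅◅ uv ◅ ε) , uv)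
        ◅ inside (i∼u ◅◅ uv ◅ ε) v∼w

  bond⇒components : ∀ {π} → IsBond G π → ∀ {i j} → SameBlock π i j → Star Adj i j
  bond⇒components {π} bond {i} {j} i∼j = gmap id (λ (_ , _ , uv) → uv)
    (All.lookup bond (∈-blocks⁺ π i) i j (∈-block⁺ π (same-refl π)) (∈-block⁺ π i∼j))

-- The signed count of D-permutations

cyc-cong : ∀ {n} {σ τ : Permutation′ n} → σ Perm.≈ τ → cyc σ ≈ₚ cyc τ
cyc-cong {σ = σ} {τ} σ≈τ =
  SameCycle-least σ (cyc τ) (λ i → subst (SameCycle τ i) (sym (σ≈τ i)) (step τ i)) ,
  SameCycle-least τ (cyc σ) (λ i → subst (SameCycle σ i) (σ≈τ i) (step σ i))

twist-twist : ∀ {n} {σ τ ρ : Permutation′ n} {a b} → Twist σ τ a b → Twist τ ρ a b → ρ Perm.≈ σ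
twist-twist {a = a} {b} t t′ i with i Fin.≟ a | i Fin.≟ b
... | yes refl | _        = trans (Twist.at-a t′) (Twist.at-b t)
... | no _     | yes refl = trans (Twist.at-b t′) (Twist.at-a t)
... | no i≢a   | no i≢b   = trans (Twist.at-else t′ i≢a i≢b) (Twist.at-else t i≢a i≢b)

module _ (A : List ℕ) where

  private
    n : ℕ
    n = length A
    L : FinitePoset _ _ _
    L = bondLattice (Γ A)
    module L = FinitePoset L
    Perms : List (Permutation′ n)
    Perms = permutations n
    D? : ∀ σ → Dec (IsDPermutation A σ)
    D? = isDPermutation? A

  -- For `k ≤ n` the exponents `n + k` and `n - k` have the same parity, so this is the sign of a
  -- permutation of `n` points with `k` cycles.
  sgn : ℕ → ℤ
  sgn k = -1ℤ ^ (n + k)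

  sgn-suc : ∀ k → sgn (suc k) ≡ ℤ.- sgn k
  sgn-suc k = trans (cong (-1ℤ ^_) (ℕ.+-suc n k)) (ℤ.-1*i≡-i (sgn k))

  sgn-square : ∀ k → sgn k * sgn k ≡ 1ℤ
  sgn-square k = trans (sym (ℤ.^-distribˡ-+-* -1ℤ (n + k) (n + k))) (-1^[m+m]≡1 (n + k))

  -- Double counting: each D-permutation belongs to the fibre of exactly one index up to `≈`, where
  -- the weight `u` agrees with `v σ`. It is used for fibres by cycle support and for fibres by
  -- number of cycles.
  ∑-fibres : ∀ {c ℓ r} (S : Setoid c ℓ) → let open Setoid S using (Carrier; _≈_) in
             ∀ {ks} → UniqueS.Unique S ks →
             {R : Permutation′ n → Carrier → Set r} (R? : ∀ σ k → Dec (R σ k)) →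
             (u : Carrier → ℤ) (v : Permutation′ n → ℤ) →
             (∀ σ → IsDPermutation A σ → ∃[ k ] Any (k ≈_) ks ×
               (∀ {l} → R σ l → k ≈ l) × (∀ {l} → k ≈ l → R σ l) ×
               (∀ {l} → k ≈ l → u l ≡ v σ)) →
             ∑ ks (λ k → u k * + count (λ σ → D? σ ×-dec R? σ k)) ≡
             ∑ Perms (λ σ → when (D? σ) (v σ))
  ∑-fibres S {ks} ks! R? u v value = begin
    ∑ ks (λ k → u k * + count (λ σ → D? σ ×-dec R? σ k))
      ≡⟨ ∑-cong (λ k → trans (cong (u k *_) (length-filter-∑ (λ σ → D? σ ×-dec R? σ k) Perms))
           (trans (∑-*ˡ (u k) _ Perms) (∑-cong (λ σ → term k σ) Perms))) ks ⟩
    ∑ ks (λ k → ∑ Perms λ σ → when (D? σ) (when (R? σ k) (u k)))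
      ≡⟨ ∑-swap _ ks Perms ⟩
    ∑ Perms (λ σ → ∑ ks λ k → when (D? σ) (when (R? σ k) (u k)))
      ≡⟨ ∑-cong (λ σ → trans (sym (∑-when (D? σ) _ ks)) (when-congʳ (D? σ) (fibre σ))) Perms ⟩
    ∑ Perms (λ σ → when (D? σ) (v σ)) ∎
    where
    open ≡-Reasoning
    term : ∀ k σ → u k * when (D? σ ×-dec R? σ k) 1ℤ ≡ when (D? σ) (when (R? σ k) (u k))
    term k σ = trans (when-*ˡ (D? σ ×-dec R? σ k) (u k) 1ℤ)
      (trans (cong (when (D? σ ×-dec R? σ k)) (ℤ.*-identityʳ (u k)))
        (when-× (D? σ) (R? σ k) (D? σ ×-dec R? σ k)))
    fibre : ∀ σ → IsDPermutation A σ → ∑ ks (λ k → when (R? σ k) (u k)) ≡ v σ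
    fibre σ D with value σ D
    ... | k , k∈ , to , from , u≡ = trans
      (∑-single S (R? σ) u ks! k∈ to from λ e → trans (u≡ e) (sym (u≡ (Setoid.refl S))))
      (u≡ (Setoid.refl S))

  D-resp : ∀ {σ τ} → σ Perm.≈ τ → IsDPermutation A σ → IsDPermutation A τ
  D-resp σ≈τ D i rewrite sym (σ≈τ i) = D i

  #D-withSupport-resp : ∀ {π ρ} → π ≈ₚ ρ → #D-withSupport A π ≡ #D-withSupport A ρ
  #D-withSupport-resp {π} {ρ} (f , g) = cong length (List.filter-≐
    (λ σ → D? σ ×-dec (cyc σ ≈ₚ? π)) (λ σ → D? σ ×-dec (cyc σ ≈ₚ? ρ))
    ( (λ (D , to , from) → D , (λ e → f (to e)) , (λ e → from (g e)))
    , (λ (D , to , from) → D , (λ e → g (to e)) , (λ e → from (f e)))) Perms)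

  -- The candidate for the value of `μ 0̂` at `π`.
  signedSupport : Partition n → ℤ
  signedSupport π = sgn (#blocks π) * + #D-withSupport A π

  signedSupport-resp : ∀ {π ρ} → π ≈ₚ ρ → signedSupport π ≡ signedSupport ρ
  signedSupport-resp {π} {ρ} π≈ρ = cong₂ (λ k d → sgn k * + d)
    (#blocks-resp {π = π} {ρ} π≈ρ) (#D-withSupport-resp {π} {ρ} π≈ρ)

  -- The identity is the only permutation all of whose cycles are trivial, and it satisfies the
  -- D-condition.
  #D-withSupport-singletons : + #D-withSupport A singletons ≡ 1ℤ
  #D-withSupport-singletons = trans
    (length-filter-∑ (λ σ → D? σ ×-dec (cyc σ ≈ₚ? singletons)) Perms)
    (∑-single (DecSetoid.setoid (permDecSetoid n)) (λ σ → D? σ ×-dec (cyc σ ≈ₚ? singletons))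
      (λ _ → 1ℤ) {y = Perm.id} (permutations-unique n) (permutations-complete n Perm.id)
      (λ {σ} (_ , trivial , _) i → trivial (step σ i))
      (λ {σ} id≈σ →
        D-resp {Perm.id} {σ} id≈σ (λ _ → (λ _ → ℕ.≤-refl) , (λ _ → ℕ.≤-refl))
        , SameCycle-least σ singletons id≈σ , (λ { refl → same-refl (cyc σ) }))
      λ _ → refl)

  module _ (A! : Unique A) where

    -- No D-permutation is lost when the supports range over bond partitions only, by
    -- `DPermutation⇒bond`.
    ∑-bonds : (u : Partition n → ℤ) → (∀ {π ρ} → π ≈ₚ ρ → u π ≡ u ρ) →
              ∑ L.elements (λ z → u (proj₁ z) * + #D-withSupport A (proj₁ z)) ≡
              ∑ Perms (λ σ → when (D? σ) (u (cyc σ)))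
    ∑-bonds u u-resp = ∑-fibres L.Eq.setoid L.unique (λ σ z → cyc σ ≈ₚ? proj₁ z) (u ∘ proj₁) (u ∘ cyc)
      λ σ D → let β = cyc σ , DPermutation⇒bond A A! σ D in
        β , L.complete β , id , id , λ (f , g) → u-resp (g , f)

    module _ (π : Partition n) (bond : IsBond (Γ A) π) (0̂≉π : ¬ (singletons ≈ₚ π)) where

      private
        compatible? : ∀ σ → Dec (Compatible A π σ)
        compatible? σ = D? σ ×-dec Fin.all? λ i → sameBlock? π i (σ ⟨$⟩ʳ i)

        signed : Permutation′ n → ℤ
        signed σ = when (compatible? σ) (sgn (#blocks (cyc σ)))

      -- On each block of π this sum is the determinant of the 0/1 matrix of the
      -- D-condition, whose rows m and M are constant 1.
      ∑-signed≡0 : ∑ Perms signed ≡ 0ℤ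
      ∑-signed≡0 = ∑-sign-reversing (permDecSetoid n) (permutations-unique n) (permutations-complete n)
        {φ} (λ σ≈τ i → σ≈τ _) (λ σ → twist-twist (twisted σ) (twisted (φ σ))) {signed}
        (λ {σ} {τ} → signed-resp {σ} {τ}) signed-φ
        where
        open Spanned (proj₂ (nontrivial-spanned A π bond 0̂≉π))
        spanned : Spanned A π _
        spanned = proj₂ (nontrivial-spanned A π bond 0̂≉π)
        φ : Permutation′ n → Permutation′ n
        φ σ = transpose m M ∘ₚ σ
        twisted : ∀ σ → Twist σ (φ σ) m M
        twisted σ = transpose-twist σ m M
        compatible-resp : ∀ {σ τ} → σ Perm.≈ τ → Compatible A π σ → Compatible A π τ
        compatible-resp {σ} {τ} σ≈τ (D , closed) =
          D-resp {σ} {τ} σ≈τ D , λ i → subst (SameBlock π i) (σ≈τ i) (closed i)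
        signed-resp : ∀ {σ τ} → σ Perm.≈ τ → signed σ ≡ signed τ
        signed-resp {σ} {τ} σ≈τ = when-cong (compatible? σ) (compatible? τ)
          (compatible-resp {σ} {τ} σ≈τ) (compatible-resp {τ} {σ} (sym ∘ σ≈τ))
          λ _ → cong sgn (#blocks-resp {π = cyc σ} {cyc τ} (cyc-cong {σ = σ} {τ} σ≈τ))
        flip : ∀ σ → sgn (#blocks (cyc (φ σ))) ≡ ℤ.- sgn (#blocks (cyc σ))
        flip σ with #cycles-twist (twisted σ) m≢M
        ... | inj₁ e = trans (sym (ℤ.neg-involutive _))
          (cong ℤ.-_ (sym (trans (cong sgn e) (sgn-suc _))))
        ... | inj₂ e = trans (cong sgn e) (sgn-suc _)
        signed-φ : ∀ σ → signed (φ σ) ≡ ℤ.- signed σ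
        signed-φ σ = trans
          (when-cong (compatible? (φ σ)) (compatible? σ)
            (twist-compatible A π spanned (twist-inverse (twisted σ)))
            (twist-compatible A π spanned (twisted σ))
            (λ _ → flip σ))
          (when-neg (compatible? σ) _)

      -- The condition of lying below `π` is absorbed into the weight `u`. Grouping by cycle support
      -- then gives a sum over D-permutations, and `cyc σ` lies below `π` exactly when `σ` maps
      -- every point into its own block.
      ∑-signedSupport≡0 : ∑ L.elements (λ z → when (z L.≤? (π , bond)) (signedSupport (proj₁ z))) ≡ 0ℤ
      ∑-signedSupport≡0 = begin
        ∑ L.elements (λ z → when (z L.≤? (π , bond)) (signedSupport (proj₁ z)))
          ≡⟨ ∑-cong (λ z → sym (when-*ʳ (z L.≤? (π , bond)) _ _)) L.elements ⟩
        ∑ L.elements (λ z → u (proj₁ z) * + #D-withSupport A (proj₁ z))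
          ≡⟨ ∑-bonds u (λ {ρ} {ρ′} → u-resp {ρ} {ρ′}) ⟩
        ∑ Perms (λ σ → when (D? σ) (u (cyc σ)))
          ≡⟨ ∑-cong (λ σ → trans (when-congʳ (D? σ) λ _ → below-π σ)
               (sym (when-× (D? σ) (Fin.all? λ i → sameBlock? π i (σ ⟨$⟩ʳ i)) (compatible? σ)))) Perms ⟩
        ∑ Perms signed
          ≡⟨ ∑-signed≡0 ⟩
        0ℤ ∎
        where
        open ≡-Reasoning
        open DecPoset (partitionDecPoset n) using (_≤?_)
        u : Partition n → ℤ
        u ρ = when (ρ ≤? π) (sgn (#blocks ρ))
        u-resp : ∀ {ρ ρ′} → ρ ≈ₚ ρ′ → u ρ ≡ u ρ′
        u-resp {ρ} {ρ′} (f , g) = when-cong (ρ ≤? π) (ρ′ ≤? π)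
          (λ ρ≤π → ⇒-to-≤ {π = ρ′} {π} λ e → ≤-to-⇒ {π = ρ} {π} ρ≤π (g e))
          (λ ρ′≤π → ⇒-to-≤ {π = ρ} {π} λ e → ≤-to-⇒ {π = ρ′} {π} ρ′≤π (f e))
          λ _ → cong sgn (#blocks-resp {π = ρ} {ρ′} (f , g))
        below-π : ∀ σ → u (cyc σ) ≡
                  when (Fin.all? λ i → sameBlock? π i (σ ⟨$⟩ʳ i)) (sgn (#blocks (cyc σ)))
        below-π σ = when-cong (cyc σ ≤? π) (Fin.all? λ i → sameBlock? π i (σ ⟨$⟩ʳ i))
          (λ c≤π i → ≤-to-⇒ {π = cyc σ} {π} c≤π (step σ i))
          (λ closed → ⇒-to-≤ {π = cyc σ} {π} (SameCycle-least σ π closed))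
          λ _ → refl

    μ≡signedSupport : ∀ π → L.μ L.0̂ π ≡ signedSupport (proj₁ π)
    μ≡signedSupport = μ-unique L (signedSupport ∘ proj₁)
      (λ {π} {ρ} → signedSupport-resp {proj₁ π} {proj₁ ρ})
      -- At the partition into singletons the sign is `-1ℤ ^ (n + n)` and only the identity is
      -- counted.
      (cong₂ _*_ (trans (cong sgn (#blocks-singletons n)) (-1^[m+m]≡1 n)) #D-withSupport-singletons)
      λ (π , bond) → ∑-signedSupport≡0 π bond

    -- Ranks and the characteristic polynomial

    #blocks-decreasing : ∀ {z y} → z L.< y → #blocks (proj₁ y) < #blocks (proj₁ z)
    #blocks-decreasing {z , _} {y , _} (z≤y , z≉y)
      -- Strictness only denies equivalence; a search over all pairs turns it into two vertices
      -- joined in `y` but not in `z`.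
      with Fin.any? (λ i → Fin.any? λ j → sameBlock? y i j ×-dec ¬? (sameBlock? z i j))
    ... | yes (i , j , i∼j , i≁j) =
      #blocks-strictly-antitone {π = z} {y} (≤-to-⇒ {π = z} {y} z≤y) i≁j i∼j
    ... | no ¬found = ⊥-elim (z≉y (≤-to-⇒ {π = z} {y} z≤y , back))
      where
      back : ∀ {i j} → SameBlock y i j → SameBlock z i j
      back {i} {j} i∼j with sameBlock? z i j
      ... | yes i∼′j = i∼′j
      ... | no i≁j   = contradiction (i , j , i∼j , i≁j) ¬found

    rk≡ : ∀ π → L.rk π ≡ n ∸ #blocks (proj₁ π)
    rk≡ = rk-unique L (λ π → n ∸ #blocks (proj₁ π))
      (λ {π} {ρ} π≈ρ → cong (n ∸_) (#blocks-resp {π = proj₁ π} {proj₁ ρ} π≈ρ))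
      (trans (cong (n ∸_) (#blocks-singletons n)) (ℕ.n∸n≡0 n))
      (λ {z} {y} z<y → ℕ.∸-monoʳ-< (#blocks-decreasing {z} {y} z<y) (#blocks≤n (proj₁ z)))
      cover
      where
      cover : ∀ y → ¬ L.0̂ L.≈ y → ∃[ z ] z L.< y × suc (n ∸ #blocks (proj₁ z)) ≡ n ∸ #blocks (proj₁ y)
      cover (π , bond) 0̂≉π with bond-cover A π bond 0̂≉π
      ... | x , y , x∼y , x≢y , bond′ =
        (isolate π x , bond′)
        , (⇒-to-≤ {π = isolate π x} {π} (isolate-⇒ π x)
          , λ (_ , back) → x≢y (isolate-alone π x y (back x∼y)))
        -- The subtraction is truncated, so `suc (#blocks π) ≤ n` is required; it holds because the
        -- partition with `x` isolated has at most `n` blocks.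
        , trans (cong (λ k → suc (n ∸ k)) #≡)
            (sym (ℕ.+-∸-assoc 1 (subst (ℕ._≤ n) #≡ (#blocks≤n (isolate π x)))))
        where
        #≡ : #blocks (isolate π x) ≡ suc (#blocks π)
        #≡ = #blocks-isolate π x∼y x≢y

    private
      c : ℕ
      c = #components A

    c≤#blocks : ∀ {π} → IsBond (Γ A) π → c ℕ.≤ #blocks π
    c≤#blocks {π} bond = #blocks-antitone {π = π} {components (Γ A)} (bond⇒components (Γ A) {π} bond)

    -- The rank is largest at the partition into connected components, which every bond partition
    -- refines.
    len≡ : L.len ≡ n ∸ c
    len≡ = ℕ.≤-antisym (upper L.elements) (lower (L.complete β))
      where
      β : Bond (Γ A)
      β = components (Γ A) , components-bond (Γ A)
      upper : ∀ πs → foldr _⊔_ 0 (map L.rk πs) ℕ.≤ n ∸ c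
      upper []              = ℕ.z≤n
      upper ((π , bond) ∷ πs) = ℕ.⊔-lub
        (ℕ.≤-trans (ℕ.≤-reflexive (rk≡ (π , bond))) (ℕ.∸-monoʳ-≤ n (c≤#blocks {π} bond))) (upper πs)
      lower : ∀ {πs} → Any (β L.≈_) πs → n ∸ c ℕ.≤ foldr _⊔_ 0 (map L.rk πs)
      lower {π ∷ _} (here β≈π) = ℕ.≤-trans
        (ℕ.≤-reflexive (trans (cong (n ∸_) (#blocks-resp {π = proj₁ β} {proj₁ π} β≈π)) (sym (rk≡ π))))
        (ℕ.m≤m⊔n _ _)
      lower {π ∷ _} (there p) = ℕ.≤-trans (lower p) (ℕ.m≤n⊔m (L.rk π) _)

    -- The length and the rank are both measured down from `n`, which cancels because no partition
    -- has more than `n` blocks.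
    corank : ∀ π → L.len ∸ L.rk π ≡ #blocks (proj₁ π) ∸ c
    corank π@(ρ , _) = begin
      L.len ∸ L.rk π             ≡⟨ cong₂ _∸_ len≡ (rk≡ π) ⟩
      n ∸ c ∸ (n ∸ #blocks ρ)    ≡⟨ ℕ.∸-+-assoc n c (n ∸ #blocks ρ) ⟩
      n ∸ (c + (n ∸ #blocks ρ))  ≡⟨ cong (n ∸_) (ℕ.+-comm c (n ∸ #blocks ρ)) ⟩
      n ∸ (n ∸ #blocks ρ + c)    ≡⟨ ℕ.∸-+-assoc n (n ∸ #blocks ρ) c ⟨
      n ∸ (n ∸ #blocks ρ) ∸ c    ≡⟨ cong (_∸ c) (ℕ.m∸[m∸n]≡n (#blocks≤n ρ)) ⟩
      #blocks ρ ∸ c              ∎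
      where open ≡-Reasoning

    -- Both coefficients at `j` equal one sum over D-permutations, in which `σ` counts with the sign
    -- of its number of cycles if that number minus `c` is `j`. The lattice side groups it by cycle
    -- support, the other side by number of cycles.
    χ≡ : ∀ j → L.χ j ≡ sumFromTo c n (λ k → monomial (s-D A k) (k ∸ c)) j
    χ≡ j = begin
      L.χ j
        ≡⟨ cong sumℤ (List.map-∘ L.elements) ⟨
      ∑ L.elements (λ π → monomial (L.μ L.0̂ π) (L.len ∸ L.rk π) j)
        ≡⟨ ∑-cong (λ π → trans (cong₂ (λ a e → monomial a e j) (μ≡signedSupport π) (corank π))
             (sym (when-*ʳ (#blocks (proj₁ π) ∸ c ℕ.≟ j) _ _))) L.elements ⟩
      ∑ L.elements (λ π → u (#blocks (proj₁ π)) * + #D-withSupport A (proj₁ π))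
        ≡⟨ ∑-bonds (u ∘ #blocks) (λ {π} {ρ} π≈ρ → cong u (#blocks-resp {π = π} {ρ} π≈ρ)) ⟩
      ∑ Perms (λ σ → when (D? σ) (u (#blocks (cyc σ))))
        ≡⟨ ∑-fibres (setoid ℕ) ks! (λ σ k → #blocks (cyc σ) ℕ.≟ k) u (u ∘ #blocks ∘ cyc)
             (λ σ D → #blocks (cyc σ)
               , ∈-ks (c≤#blocks {cyc σ} (DPermutation⇒bond A A! σ D)) (#blocks≤n (cyc σ))
               , id , id , λ { refl → refl }) ⟨
      ∑ ks (λ k → u k * + #D-withCycles A k)
        ≡⟨ ∑-cong (λ k → when-*ʳ (k ∸ c ℕ.≟ j) (sgn k) (+ #D-withCycles A k)) ks ⟩
      ∑ ks (λ k → monomial (s-D A k) (k ∸ c) j)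
        ≡⟨ cong sumℤ (trans (List.map-applyUpTo (λ i → c + i) _ (suc n ∸ c))
             (sym (List.map-applyUpTo (λ i → monomial (s-D A (c + i)) (c + i ∸ c))
               (λ p → p j) (suc n ∸ c)))) ⟩
      sumFromTo c n (λ k → monomial (s-D A k) (k ∸ c)) j ∎
      where
      open ≡-Reasoning
      u : ℕ → ℤ
      u k = when (k ∸ c ℕ.≟ j) (sgn k)
      -- The number of cycles of a D-permutation lies in this range: it is at least `c` because the
      -- support is a bond partition, and at most `n`.
      ks : List ℕ
      ks = applyUpTo (λ i → c + i) (suc n ∸ c)
      ks! : Unique ks
      ks! = UniqueP.applyUpTo⁺₁ (λ i → c + i) (suc n ∸ c) λ i<j _ e → ℕ.<⇒≢ i<j (ℕ.+-cancelˡ-≡ c _ _ e)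
      ∈-ks : ∀ {k} → c ℕ.≤ k → k ℕ.≤ n → Any (k ≡_) ks
      ∈-ks {k} c≤k k≤n = subst (λ l → Any (l ≡_) ks) (ℕ.m+[n∸m]≡n c≤k)
        (∈.∈-applyUpTo⁺ (λ i → c + i) (ℕ.∸-monoˡ-< (ℕ.s≤s k≤n) c≤k))

theorem4p9 : (A : List ℕ) → Unique A → All (0 <_) A →
    ((π : Bond (Γ A)) →
    -1ℤ ^ (length A + #blocks (proj₁ π)) *
    FinitePoset.μ (bondLattice (Γ A)) (FinitePoset.0̂ (bondLattice (Γ A))) π
    ≡ + #D-withSupport A (proj₁ π))
    × FinitePoset.χ (bondLattice (Γ A)) ≗
    sumFromTo (#components A) (length A)
    (λ k → monomial (s-D A k) (k ∸ #components A))
theorem4p9 A A! _ = support , χ≡ A A!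
  where
  support : (π : Bond (Γ A)) →
    -1ℤ ^ (length A + #blocks (proj₁ π)) *
    FinitePoset.μ (bondLattice (Γ A)) (FinitePoset.0̂ (bondLattice (Γ A))) π
    ≡ + #D-withSupport A (proj₁ π)
  support π = begin
    s * FinitePoset.μ (bondLattice (Γ A)) (FinitePoset.0̂ (bondLattice (Γ A))) π
      ≡⟨ cong (s *_) (μ≡signedSupport A A! π) ⟩
    -- The sign in `signedSupport` is the sign of the statement, so the two multiply to 1.
    s * (s * d)  ≡⟨ ℤ.*-assoc s s d ⟨
    s * s * d    ≡⟨ cong (_* d) (sgn-square A (#blocks (proj₁ π))) ⟩
    1ℤ * d       ≡⟨ ℤ.*-identityˡ d ⟩
    d            ∎
    where
    open ≡-Reasoning
    s d : ℤ
    s = sgn A (#blocks (proj₁ π))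
    d = + #D-withSupport A (proj₁ π)
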